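{- Every connected graph $G$ on $n$ vertices admits a universal set of proper 4-tuples of vertices of $G$, of size $O(n^2)$. Moreover, such a set can be found (given $G$) in time $O(n^3)$.
   Context: Graphs are finite, simple and undirected. A partition $(X_1,X_2)$ of the vertex set of a graph $G$ is a \emph{2-join} if for $i=1,2$ there exist disjoint non-empty sets $A_i,B_i\subseteq X_i$ such that: every vertex of $A_1$ is adjacent to every vertex of $A_2$, every vertex of $B_1$ is adjacent to every vertex of $B_2$, and there are no other edges between $X_1$ and $X_2$; and $|X_i|\ge 3$ for $i=1,2$. A 4-tuple $(a_1,a_2,b_1,b_2)$ of vertices of $G=(V,E)$ is \emph{proper} if $a_1,b_1,a_2,b_2$ are pairwise distinct, $a_1a_2,b_1b_2\in E$ and $a_1b_2,b_1a_2\notin E$. It is \emph{compatible} with a 2-join $(X_1,X_2)$ of $G$ if $a_1,b_1\in X_1$ and $a_2,b_2\in X_2$. A set $U$ of proper 4-tuples of vertices of $G$ is \emph{universal} if for every 2-join $(X_1,X_2)$ of $G$, at least one 4-tuple from $U$ is compatible with $(X_1,X_2)$. -}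

module Defs where

open import Data.Fin.Base using (Fin; toℕ; fromℕ<)
open import Data.Fin.Subset using (Subset; _∈_; _⊆_; Nonempty; Empty; _∩_; ∣_∣)
open import Data.Bool.Base using (if_then_else_)
open import Data.List.Base using (List; []; _∷_; _∷ʳ_; concatMap)
open import Data.List.Relation.Unary.All using (All)
open import Data.List.Relation.Unary.Any using (Any)
open import Data.Nat.Base using (ℕ; zero; suc; _+_; _*_; _∸_; _≤_)
open import Data.Nat.Properties using (_≟_; _<?_)
open import Data.Product.Base using (_×_; ∃-syntax)
open import Data.Sum.Base using (_⊎_)
open import Level using (0ℓ)
open import Relation.Binary.Core using (Rel)
open import Relation.Binary.Construct.Closure.ReflexiveTransitive using (Star)
open import Relation.Binary.Definitions using (Symmetric; Irreflexive; Decidable)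
open import Relation.Binary.PropositionalEquality using (_≡_; _≢_)
open import Relation.Nullary.Decidable.Core using (does; yes; no)
open import Relation.Nullary.Negation.Core using (¬_)

------------------------------------------------------------------------
-- Graphs, 2-joins and universal sets

record Graph (n : ℕ) : Set₁ where
  infix 4 _~_ _~?_
  field
    _~_    : Rel (Fin n) 0ℓ
    sym    : Symmetric _~_
    irrefl : Irreflexive _≡_ _~_
    _~?_   : Decidable _~_

-- The graph without vertices is not regarded as connected.
record Connected {n : ℕ} (G : Graph n) : Set where
  open Graph G
  field
    vertex : Fin n
    path   : ∀ u v → Star _~_ u v

record TwoJoin {n : ℕ} (G : Graph n) (X₁ X₂ : Subset n) : Set where
  open Graph G
  field
    covering : ∀ v → v ∈ X₁ ⊎ v ∈ X₂
    disjoint : Empty (X₁ ∩ X₂)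
    A₁ B₁ A₂ B₂ : Subset n
    A₁⊆X₁ : A₁ ⊆ X₁
    B₁⊆X₁ : B₁ ⊆ X₁
    A₂⊆X₂ : A₂ ⊆ X₂
    B₂⊆X₂ : B₂ ⊆ X₂
    A₁-nonempty : Nonempty A₁
    B₁-nonempty : Nonempty B₁
    A₂-nonempty : Nonempty A₂
    B₂-nonempty : Nonempty B₂
    A₁B₁-disjoint : Empty (A₁ ∩ B₁)
    A₂B₂-disjoint : Empty (A₂ ∩ B₂)
    A-complete : ∀ {u v} → u ∈ A₁ → v ∈ A₂ → u ~ v
    B-complete : ∀ {u v} → u ∈ B₁ → v ∈ B₂ → u ~ v
    no-other   : ∀ {u v} → u ∈ X₁ → v ∈ X₂ → u ~ v →
                 (u ∈ A₁ × v ∈ A₂) ⊎ (u ∈ B₁ × v ∈ B₂)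
    3≤∣X₁∣ : 3 ≤ ∣ X₁ ∣
    3≤∣X₂∣ : 3 ≤ ∣ X₂ ∣

record Tuple (n : ℕ) : Set where
  constructor ⟨_,_,_,_⟩
  field
    a₁ a₂ b₁ b₂ : Fin n

record Proper {n : ℕ} (G : Graph n) (q : Tuple n) : Set where
  open Graph G
  open Tuple q
  field
    a₁≢b₁ : a₁ ≢ b₁
    a₁≢a₂ : a₁ ≢ a₂
    a₁≢b₂ : a₁ ≢ b₂
    b₁≢a₂ : b₁ ≢ a₂
    b₁≢b₂ : b₁ ≢ b₂
    a₂≢b₂ : a₂ ≢ b₂
    a₁~a₂ : a₁ ~ a₂
    b₁~b₂ : b₁ ~ b₂
    a₁≁b₂ : ¬ (a₁ ~ b₂)
    b₁≁a₂ : ¬ (b₁ ~ a₂)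

Compatible : ∀ {n} → Subset n → Subset n → Tuple n → Set
Compatible X₁ X₂ q = a₁ ∈ X₁ × b₁ ∈ X₁ × a₂ ∈ X₂ × b₂ ∈ X₂
  where open Tuple q

-- A finite set of tuples is given by a list of its elements; the length
-- of the list is an upper bound for the size of the set.
record UniversalSet {n : ℕ} (G : Graph n) (U : List (Tuple n)) : Set where
  field
    proper    : All (Proper G) U
    universal : ∀ X₁ X₂ → TwoJoin G X₁ X₂ → Any (Compatible X₁ X₂) U

------------------------------------------------------------------------
-- A word RAM with structured control flow.  The input graph is accessible
-- through n (in variable 0) and a read-only adjacency matrix.  Variables
-- and arrays are named by numerals in the program text, so that a program
-- uses only constantly many of them.

infixl 6 _⊕_ _⊖_
infixl 7 _⊗_

data Expr : Set where
  const       : ℕ → Expr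
  var         : ℕ → Expr
  arr         : ℕ → Expr → Expr
  adj         : Expr → Expr → Expr
  _⊕_ _⊖_ _⊗_ : Expr → Expr → Expr

infix  5 _≔_ _[_]≔_
infixr 4 _⨾_

data Cmd : Set where
  skip   : Cmd
  _≔_    : ℕ → Expr → Cmd
  _[_]≔_ : ℕ → Expr → Expr → Cmd
  write  : Expr → Cmd
  _⨾_    : Cmd → Cmd → Cmd
  cond   : Expr → Cmd → Cmd → Cmd
  while  : Expr → Cmd → Cmd

record State : Set where
  constructor state
  field
    vars : ℕ → ℕ
    arrs : ℕ → ℕ → ℕ
    out  : List ℕ

open State public

_[_↦_] : {A : Set} → (ℕ → A) → ℕ → A → ℕ → A
(f [ i ↦ x ]) j = if does (i ≟ j) then x else f j

initial : ℕ → State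
initial n = state ((λ _ → 0) [ 0 ↦ n ]) (λ _ _ → 0) []

adjacency : ∀ {n} → Graph n → ℕ → ℕ → ℕ
adjacency {n} G i j with i <? n | j <? n
... | yes i<n | yes j<n = if does (fromℕ< i<n ~? fromℕ< j<n) then 1 else 0
  where open Graph G
... | _       | _       = 0

eval : ∀ {n} → Graph n → State → Expr → ℕ
eval G σ (const k) = k
eval G σ (var x)   = vars σ x
eval G σ (arr a e) = arrs σ a (eval G σ e)
eval G σ (adj d e) = adjacency G (eval G σ d) (eval G σ e)
eval G σ (d ⊕ e)   = eval G σ d + eval G σ e
eval G σ (d ⊖ e)   = eval G σ d ∸ eval G σ e
eval G σ (d ⊗ e)   = eval G σ d * eval G σ e

-- Every operation has unit cost.
cost : Expr → ℕ
cost (const _) = 1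
cost (var _)   = 1
cost (arr _ e) = suc (cost e)
cost (adj d e) = suc (cost d + cost e)
cost (d ⊕ e)   = suc (cost d + cost e)
cost (d ⊖ e)   = suc (cost d + cost e)
cost (d ⊗ e)   = suc (cost d + cost e)

-- Exec G W c σ τ t : started in σ, the command c halts in τ after t steps,
-- and all numbers it stores, writes or uses as addresses of stores are at
-- most W.  (Intermediate values of an expression, including addresses of
-- reads, are then bounded by a polynomial in n + W that depends only on
-- the expression.)  Guards are true when nonzero.
data Exec {n : ℕ} (G : Graph n) (W : ℕ) : Cmd → State → State → ℕ → Set where

  skip : ∀ {σ} → Exec G W skip σ σ 1

  assign : ∀ {σ x e} → eval G σ e ≤ W →
    Exec G W (x ≔ e) σ
      (record σ { vars = vars σ [ x ↦ eval G σ e ] })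
      (suc (cost e))

  store : ∀ {σ a d e} → eval G σ d ≤ W → eval G σ e ≤ W →
    Exec G W (a [ d ]≔ e) σ
      (record σ { arrs = arrs σ [ a ↦ arrs σ a [ eval G σ d ↦ eval G σ e ] ] })
      (suc (cost d + cost e))

  write : ∀ {σ e} → eval G σ e ≤ W →
    Exec G W (write e) σ
      (record σ { out = out σ ∷ʳ eval G σ e })
      (suc (cost e))

  seq : ∀ {σ τ υ c d s t} → Exec G W c σ τ s → Exec G W d τ υ t →
    Exec G W (c ⨾ d) σ υ (s + t)

  cond-true : ∀ {σ τ e c d t} → eval G σ e ≢ 0 → Exec G W c σ τ t →
    Exec G W (cond e c d) σ τ (suc (cost e + t))

  cond-false : ∀ {σ τ e c d t} → eval G σ e ≡ 0 → Exec G W d σ τ t →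
    Exec G W (cond e c d) σ τ (suc (cost e + t))

  while-true : ∀ {σ τ υ e c s t} → eval G σ e ≢ 0 →
    Exec G W c σ τ s → Exec G W (while e c) τ υ t →
    Exec G W (while e c) σ υ (suc (cost e + (s + t)))

  while-false : ∀ {σ e c} → eval G σ e ≡ 0 →
    Exec G W (while e c) σ σ (suc (cost e))

encode : ∀ {n} → List (Tuple n) → List ℕ
encode = concatMap λ q → let open Tuple q in
  toℕ a₁ ∷ toℕ a₂ ∷ toℕ b₁ ∷ toℕ b₂ ∷ []

Computes : ∀ {n} → Cmd → (W T : ℕ) → Graph n → List (Tuple n) → Set
Computes {n} P W T G U =
  ∃[ σ ] ∃[ t ] Exec G W P (initial n) σ t × out σ ≡ encode U × t ≤ T

{-# OPTIONS --safe #-}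

-- Let d and p be the levels and parents of a breadth-first tree rooted at r.
-- Three families of O(n²) candidates aa′bb′ suffice, up to exchanging sides:
--   (1) two tree edges;
--   (2) a tree edge aa′ and an edge of a spanning forest of the graph obtained
--       by deleting all edges between N(a) and N(a′);
--   (3) for each vertex b′, consecutive elements a′ and b of the set of its
--       neighbours on the preceding level, with a = p a′.
-- Given a 2-join, let a′ be a vertex of minimal level on the side without r,
-- and a = p a′; say that aa′ joins A₁ to A₂.  The deletion in (2) removes every
-- edge between A₁ and A₂, so if an edge between B₁ and B₂ is kept, then the
-- forest contains one.  Otherwise any b in B₁ and b′ in B₂ form a square with
-- aa′.  If b′ is on the level of a′, then its parent is on the side of r, and
-- (1) works.  Otherwise b′ is one level further, and its neighbours on the level
-- of a′ include a′ and b, so that two consecutive ones x and y lie on different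
-- sides, x on that of a′; then y is in B₁, and x with its parent, which is on
-- the side of r, gives either (3) or (1).
module Submission where

open import Defs
open import Data.Bool.Base using (Bool; true; false; T; not; _∨_; if_then_else_)
import Data.Bool.Properties as Bool
open import Data.Empty using (⊥; ⊥-elim)
open import Data.Fin.Base using (Fin; toℕ; fromℕ<)
open import Data.Fin.Properties using (toℕ<n; toℕ-fromℕ<; fromℕ<-toℕ; toℕ-injective; pigeonhole)
open import Data.Fin.Subset using (Subset; Nonempty) renaming (_∈_ to _∈ˢ_; _⊆_ to _⊆ˢ_)
open import Data.Fin.Subset.Properties using (_∈?_; x∈p∩q⁺)
open import Data.List.Base using (List; []; _∷_; _∷ʳ_; _++_; length; map)
open import Data.List.Membership.Propositional using (_∈_; lose)
open import Data.List.Membership.Propositional.Properties using (∈-++⁺ˡ; ∈-++⁺ʳ)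
open import Data.List.Properties using (++-assoc; ++-identityʳ; length-++; concatMap-++)
open import Data.List.Relation.Binary.Subset.Propositional using (_⊆_)
open import Data.List.Relation.Unary.All using (All; []; _∷_)
open import Data.List.Relation.Unary.All.Properties using (++⁺)
open import Data.List.Relation.Unary.Any using (Any; here; there)
open import Data.Nat.Base
open import Data.Nat.Properties
open import Data.Nat.Solver using (module +-*-Solver)
open import Data.Product.Base using (_×_; _,_; proj₁; proj₂; ∃-syntax)
import Data.Sum.Base as Sum
open import Data.Sum.Base using (_⊎_; inj₁; inj₂)
open import Data.Unit.Base using (⊤)
open import Function.Base using (_∘_; _$_)
open import Relation.Binary.Construct.Closure.ReflexiveTransitive using (Star; ε; _◅_)
open import Relation.Binary.Definitions using (tri<; tri≈; tri>)
open import Relation.Binary.PropositionalEquality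
open import Relation.Nullary
open import Relation.Nullary.Decidable using (dec-true; dec-false; decidable-stable; _×-dec_; ¬?)

-- The algorithm sees neither the 2-join nor its sides. Hence the invariants are proved for an
-- arbitrary two-colouring `s` of the vertices that occurs only in proofs, and each proper candidate
-- is emitted together with its mirror image. A spanning forest enters through its cut property: if
-- an edge of the graph joins different colours, then so does an edge of the forest.
--
-- The other concern is the machine. All loops of the source language run n times, so `run` is a
-- total function on configurations and loops are treated by invariants; one simulation lemma,
-- `exec`, carries the results over to the machine. Running time, number of outputs and modified
-- variables are computed from the syntax. A stored number exceeds the maximum in memory by at most
-- one, so a bound on the time also bounds the numbers.
--
-- The cubic budget leaves quadratic time for each tree edge, which suffices to build a forest with
-- component labels, and it admits a breadth-first search that scans all pairs of vertices once per
-- level.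

upd-same : ∀ {A : Set} (f : ℕ → A) i x → (f [ i ↦ x ]) i ≡ x
upd-same f i x rewrite dec-true (i ≟ i) refl = refl

upd-other : ∀ {A : Set} (f : ℕ → A) {i j} x → i ≢ j → (f [ i ↦ x ]) j ≡ f j
upd-other f {i} {j} x i≢j rewrite dec-false (i ≟ j) i≢j = refl

factorˡ≢0 : ∀ m n → m * n ≢ 0 → m ≢ 0
factorˡ≢0 m n mn≢0 refl = mn≢0 refl

factorʳ≢0 : ∀ m n → m * n ≢ 0 → n ≢ 0
factorʳ≢0 m n mn≢0 refl = mn≢0 (*-zeroʳ m)

product≢0 : ∀ m n → m ≢ 0 → n ≢ 0 → m * n ≢ 0
product≢0 m n m≢0 n≢0 mn≡0 with m*n≡0⇒m≡0∨n≡0 m mn≡0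
... | inj₁ m≡0 = m≢0 m≡0
... | inj₂ n≡0 = n≢0 n≡0

1∸m≢0⇒m≡0 : ∀ m → 1 ∸ m ≢ 0 → m ≡ 0
1∸m≢0⇒m≡0 zero    _   = refl
1∸m≢0⇒m≡0 (suc m) ≢0 = ⊥-elim (≢0 (0∸n≡0 m))

m∸n+n∸m≡0⇒m≡n : ∀ m n → (m ∸ n) + (n ∸ m) ≡ 0 → m ≡ n
m∸n+n∸m≡0⇒m≡n m n eq =
  ≤-antisym (m∸n≡0⇒m≤n (m+n≡0⇒m≡0 (m ∸ n) eq)) (m∸n≡0⇒m≤n (m+n≡0⇒n≡0 (m ∸ n) eq))

m∸m+m∸m≡0 : ∀ m → (m ∸ m) + (m ∸ m) ≡ 0
m∸m+m∸m≡0 m = cong₂ _+_ (n∸n≡0 m) (n∸n≡0 m)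

∨-false : ∀ {a b} → a ∨ b ≡ false → a ≡ false × b ≡ false
∨-false {false} eq = refl , eq

not-T : ∀ {b} → T (not b) → b ≡ false
not-T {false} _ = refl

does≟-false : ∀ {x y} → does (x ≟ y) ≡ false → x ≢ y
does≟-false {x} eq refl with () ← trans (sym (dec-true (x ≟ x) refl)) eq

infix 5 _≠ᵉ_ _==ᵉ_

-- Since subtraction is truncated, the sum of both differences is the distance of the two values,
-- nonzero exactly if they differ; subtraction from 1 negates a truth value.
_≠ᵉ_ _==ᵉ_ : Expr → Expr → Expr
d ≠ᵉ e  = (d ⊖ e) ⊕ (e ⊖ d)
d ==ᵉ e = const 1 ⊖ (d ≠ᵉ e)

notᵉ : Expr → Expr
notᵉ e = const 1 ⊖ e

-- A language of bounded loops

infixr 4 _▸_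

-- Every for loop runs its counter through 0, ..., n - 1, and the only
-- output is emit, which writes a tuple and its mirror image if it is proper.
data Prog : Set where
  set  : ℕ → Expr → Prog
  put  : ℕ → Expr → Expr → Prog
  emit : (a₁ a₂ b₁ b₂ : Expr) → Prog
  _▸_  : Prog → Prog → Prog
  when : Expr → Prog → Prog
  for  : ℕ → Prog → Prog

properᵉ : (a₁ a₂ b₁ b₂ : Expr) → Expr
properᵉ a₁ a₂ b₁ b₂ =
  adj a₁ a₂ ⊗ (adj b₁ b₂ ⊗ (notᵉ (adj a₁ b₂) ⊗ (notᵉ (adj b₁ a₂) ⊗ ((a₁ ≠ᵉ b₂) ⊗ (b₁ ≠ᵉ a₂)))))

mirrored : {A : Set} (a₁ a₂ b₁ b₂ : A) → List A
mirrored a₁ a₂ b₁ b₂ = a₁ ∷ a₂ ∷ b₁ ∷ b₂ ∷ a₂ ∷ a₁ ∷ b₂ ∷ b₁ ∷ []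

writes : List Expr → Cmd
writes []       = skip
writes (e ∷ es) = write e ⨾ writes es

compile : Prog → Cmd
compile (set x e)           = x ≔ e
compile (put a d e)         = a [ d ]≔ e
compile (emit a₁ a₂ b₁ b₂) = cond (properᵉ a₁ a₂ b₁ b₂) (writes (mirrored a₁ a₂ b₁ b₂)) skip
compile (c ▸ d)             = compile c ⨾ compile d
compile (when e c)          = cond e (compile c) skip
compile (for x c)           =
  x ≔ const 0 ⨾ while (var 0 ⊖ var x) (compile c ⨾ x ≔ var x ⊕ const 1)

-- A syntactic over-approximation of the registers that a program changes; `puts` does the same for
-- arrays. Both compute on closed programs, so that frame conditions are discharged by `refl`.
sets : Prog → ℕ → Bool
sets (set x _)      y = does (x ≟ y)
sets (put _ _ _)    y = false
sets (emit _ _ _ _) y = false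
sets (c ▸ d)        y = sets c y ∨ sets d y
sets (when _ c)     y = sets c y
sets (for x c)      y = does (x ≟ y) ∨ sets c y

puts : Prog → ℕ → Bool
puts (set _ _)      b = false
puts (put a _ _)    b = does (a ≟ b)
puts (emit _ _ _ _) b = false
puts (c ▸ d)        b = puts c b ∨ puts d b
puts (when _ c)     b = puts c b
puts (for _ c)      b = puts c b

-- Expressions whose value exceeds the maximal number in memory by at most 1.
Small : Expr → Set
Small (const 0)           = ⊤
Small (const 1)           = ⊤
Small (var _)             = ⊤
Small (arr _ _)           = ⊤
Small (var _ ⊕ const 1)   = ⊤
Small (arr _ _ ⊕ const 1) = ⊤
Small _                   = ⊥

WellFormed : Prog → Set
WellFormed (set _ e)      = Small e
WellFormed (put _ d e)    = Small d × Small e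
WellFormed (emit _ _ _ _) = ⊤
WellFormed (c ▸ d)        = WellFormed c × WellFormed d
WellFormed (when _ c)     = WellFormed c
-- The body leaves the counter alone, so the compiled loop makes exactly n rounds. With `T`, the
-- condition reduces to the unit type on closed programs and its proof is inferred.
WellFormed (for x c)      = T (not (sets c x)) × WellFormed c

writes-cost : List Expr → ℕ
writes-cost []       = 1
writes-cost (e ∷ es) = suc (cost e) + writes-cost es

time : Prog → ℕ → ℕ
time (set _ e)             n = suc (cost e)
time (put _ d e)           n = suc (cost d + cost e)
time (emit a₁ a₂ b₁ b₂) n =
  suc (cost (properᵉ a₁ a₂ b₁ b₂) + writes-cost (mirrored a₁ a₂ b₁ b₂))
time (c ▸ d)               n = time c n + time d n
time (when e c)            n = suc (cost e + suc (time c n))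
-- The counter is initialised in 2 steps; each round adds 4 for the guard and 4 for the increment;
-- the last, failing guard takes 4.
time (for _ c)             n = 2 + (n * (time c n + 8) + 4)

depth : Prog → ℕ
depth (set _ _)      = 0
depth (put _ _ _)    = 0
depth (emit _ _ _ _) = 0
depth (c ▸ d)        = depth c ⊔ depth d
depth (when _ c)     = depth c
depth (for _ c)      = suc (depth c)

factor : Prog → ℕ
factor (set _ e)             = suc (cost e)
factor (put _ d e)           = suc (cost d + cost e)
factor (emit a₁ a₂ b₁ b₂) =
  suc (cost (properᵉ a₁ a₂ b₁ b₂) + writes-cost (mirrored a₁ a₂ b₁ b₂))
factor (c ▸ d)               = factor c + factor d
factor (when e c)            = suc (cost e) + 1 + factor c
factor (for _ c)             = factor c + 14

m≤m*n^k : ∀ m n k .{{_ : NonZero n}} → m ≤ m * n ^ k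
m≤m*n^k m n k = m≤m*n m (n ^ k) {{m^n≢0 n k}}

-- For nonzero n, lower powers are absorbed by the highest one. The 14 in `factor` is the 8 spent in
-- each round plus the 6 spent once per loop.
time≤ : ∀ c n .{{_ : NonZero n}} → time c n ≤ factor c * n ^ depth c
time≤ (set _ e)      n = m≤m*n^k _ n 0
time≤ (put _ d e)    n = m≤m*n^k _ n 0
time≤ (emit _ _ _ _) n = m≤m*n^k _ n 0
time≤ (c ▸ d)        n = begin
  time c n + time d n
    ≤⟨ +-mono-≤ (time≤ c n) (time≤ d n) ⟩
  factor c * n ^ depth c + factor d * n ^ depth d
    ≤⟨ +-mono-≤ (*-monoʳ-≤ (factor c) (^-monoʳ-≤ n (m≤m⊔n (depth c) (depth d))))
                (*-monoʳ-≤ (factor d) (^-monoʳ-≤ n (m≤n⊔m (depth c) (depth d)))) ⟩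
  factor c * N + factor d * N
    ≡⟨ *-distribʳ-+ N (factor c) (factor d) ⟨
  (factor c + factor d) * N ∎
  where open ≤-Reasoning
        N = n ^ (depth c ⊔ depth d)
time≤ (when e c)     n = begin
  suc (cost e + suc (time c n))
    ≡⟨ cong suc (+-suc (cost e) (time c n)) ⟩
  suc (suc (cost e + time c n))
    ≡⟨ cong (λ k → suc k + time c n) (+-comm 1 (cost e)) ⟩
  suc (cost e) + 1 + time c n
    ≤⟨ +-mono-≤ (m≤m*n^k (suc (cost e) + 1) n (depth c)) (time≤ c n) ⟩
  (suc (cost e) + 1) * n ^ depth c + factor c * n ^ depth c
    ≡⟨ *-distribʳ-+ (n ^ depth c) (suc (cost e) + 1) (factor c) ⟨
  (suc (cost e) + 1 + factor c) * n ^ depth c ∎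
  where open ≤-Reasoning
time≤ (for _ c)      n = begin
  2 + (n * (time c n + 8) + 4)
    ≡⟨ cong (2 +_) (+-comm _ 4) ⟩
  6 + n * (time c n + 8)
    ≤⟨ +-mono-≤ (m≤m*n^k 6 n (suc (depth c)))
         (*-monoʳ-≤ n (+-mono-≤ (time≤ c n) (m≤m*n^k 8 n (depth c)))) ⟩
  6 * (n * N) + n * (factor c * N + 8 * N)
    ≡⟨ solve 3 (λ f n N → con 6 :* (n :* N) :+ n :* (f :* N :+ con 8 :* N)
                       := (f :+ con 14) :* (n :* N)) refl (factor c) n N ⟩
  (factor c + 14) * (n * N) ∎
  where open ≤-Reasoning
        open +-*-Solver
        N = n ^ depth c

iterate : {A : Set} → ℕ → (A → A) → A → A
iterate zero    f x = x
iterate (suc k) f x = iterate k f (f x)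

branch : {A : Set} → ℕ → A → A → A
branch zero    x y = x
branch (suc _) x y = y

-- Adjacency and properness for vertices given as numbers

module _ {n : ℕ} (G : Graph n) where
  open Graph G renaming (sym to ~-sym)

  Adj : ℕ → ℕ → Set
  Adj i j = adjacency G i j ≡ 1

  adjacency-01 : ∀ i j → adjacency G i j ≡ 0 ⊎ Adj i j
  adjacency-01 i j with i <? n | j <? n
  ... | no _    | _       = inj₁ refl
  ... | yes _   | no _    = inj₁ refl
  ... | yes i<n | yes j<n with fromℕ< i<n ~? fromℕ< j<n
  ...   | yes _ = inj₂ refl
  ...   | no _  = inj₁ refl

  adjacency≢0⇒Adj : ∀ i j → adjacency G i j ≢ 0 → Adj i j
  adjacency≢0⇒Adj i j ≢0 with adjacency-01 i j
  ... | inj₁ ≡0 = ⊥-elim (≢0 ≡0)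
  ... | inj₂ ≡1 = ≡1

  Adj⇒≢0 : ∀ {i j} → Adj i j → adjacency G i j ≢ 0
  Adj⇒≢0 ≡1 ≡0 with () ← trans (sym ≡1) ≡0

  ¬Adj⇒≡0 : ∀ {i j} → ¬ Adj i j → adjacency G i j ≡ 0
  ¬Adj⇒≡0 {i} {j} ¬a with adjacency-01 i j
  ... | inj₁ ≡0 = ≡0
  ... | inj₂ a  = ⊥-elim (¬a a)

  Adj⇒~ : ∀ {i j} → Adj i j → ∃[ x ] ∃[ y ] toℕ x ≡ i × toℕ y ≡ j × x ~ y
  Adj⇒~ {i} {j} a with i <? n | j <? n
  Adj⇒~ () | no _    | _
  Adj⇒~ () | yes _   | no _
  Adj⇒~ a | yes i<n | yes j<n with fromℕ< i<n ~? fromℕ< j<n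
  Adj⇒~ a | yes i<n | yes j<n | yes x~y =
    _ , _ , toℕ-fromℕ< i<n , toℕ-fromℕ< j<n , x~y
  Adj⇒~ () | yes i<n | yes j<n | no _

  ~⇒Adj : ∀ {x y} → x ~ y → Adj (toℕ x) (toℕ y)
  ~⇒Adj {x} {y} x~y with toℕ x <? n | toℕ y <? n
  ... | no ≮n | _      = ⊥-elim (≮n (toℕ<n x))
  ... | yes _ | no ≮n  = ⊥-elim (≮n (toℕ<n y))
  ... | yes p | yes q with fromℕ< p ~? fromℕ< q
  ...   | yes _ = refl
  ...   | no ≁  = ⊥-elim (≁ (subst₂ _~_ (sym (fromℕ<-toℕ x p)) (sym (fromℕ<-toℕ y q)) x~y))
    where open import Data.Fin.Properties using (fromℕ<-toℕ)

module _ {n : ℕ} (G : Graph n) where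
  open Graph G renaming (sym to ~-sym)

  record IsProper (a₁ a₂ b₁ b₂ : ℕ) : Set where
    field
      a₁~a₂ : Adj G a₁ a₂
      b₁~b₂ : Adj G b₁ b₂
      a₁≁b₂ : ¬ Adj G a₁ b₂
      b₁≁a₂ : ¬ Adj G b₁ a₂
      a₁≢b₂ : a₁ ≢ b₂
      b₁≢a₂ : b₁ ≢ a₂

  properness : (a₁ a₂ b₁ b₂ : ℕ) → ℕ
  properness a₁ a₂ b₁ b₂ =
    adjacency G a₁ a₂ * (adjacency G b₁ b₂ * ((1 ∸ adjacency G a₁ b₂) * ((1 ∸ adjacency G b₁ a₂) *
      (((a₁ ∸ b₂) + (b₂ ∸ a₁)) * ((b₁ ∸ a₂) + (a₂ ∸ b₁))))))

  1∸adjacency≢0⇒¬Adj : ∀ i j → 1 ∸ adjacency G i j ≢ 0 → ¬ Adj G i j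
  1∸adjacency≢0⇒¬Adj i j ≢0 a = ≢0 (cong (1 ∸_) a)

  ¬Adj⇒1∸adjacency≢0 : ∀ {i j} → ¬ Adj G i j → 1 ∸ adjacency G i j ≢ 0
  ¬Adj⇒1∸adjacency≢0 ¬a ≡0 with () ← trans (sym (cong (1 ∸_) (¬Adj⇒≡0 G ¬a))) ≡0

  properness≢0⇒IsProper : ∀ a₁ a₂ b₁ b₂ → properness a₁ a₂ b₁ b₂ ≢ 0 → IsProper a₁ a₂ b₁ b₂
  properness≢0⇒IsProper a₁ a₂ b₁ b₂ ≢0 = record
    { a₁~a₂ = adjacency≢0⇒Adj G a₁ a₂ (factorˡ≢0 (adjacency G a₁ a₂) _ ≢0)
    ; b₁~b₂ = adjacency≢0⇒Adj G b₁ b₂ (factorˡ≢0 (adjacency G b₁ b₂) _ ≢0₁)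
    ; a₁≁b₂ = 1∸adjacency≢0⇒¬Adj a₁ b₂ (factorˡ≢0 (1 ∸ adjacency G a₁ b₂) _ ≢0₂)
    ; b₁≁a₂ = 1∸adjacency≢0⇒¬Adj b₁ a₂ (factorˡ≢0 (1 ∸ adjacency G b₁ a₂) _ ≢0₃)
    ; a₁≢b₂ = λ { refl → factorˡ≢0 _ _ ≢0₄ (m∸m+m∸m≡0 a₁) }
    ; b₁≢a₂ = λ { refl → factorʳ≢0 ((a₁ ∸ b₂) + (b₂ ∸ a₁)) _ ≢0₄ (m∸m+m∸m≡0 b₁) }
    }
    where
    ≢0₁ = factorʳ≢0 (adjacency G a₁ a₂) _ ≢0
    ≢0₂ = factorʳ≢0 (adjacency G b₁ b₂) _ ≢0₁
    ≢0₃ = factorʳ≢0 (1 ∸ adjacency G a₁ b₂) _ ≢0₂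
    ≢0₄ = factorʳ≢0 (1 ∸ adjacency G b₁ a₂) _ ≢0₃

  IsProper⇒properness≢0 : ∀ {a₁ a₂ b₁ b₂} → IsProper a₁ a₂ b₁ b₂ → properness a₁ a₂ b₁ b₂ ≢ 0
  IsProper⇒properness≢0 {a₁} {a₂} {b₁} {b₂} p =
    product≢0 (adjacency G a₁ a₂) _ (Adj⇒≢0 G a₁~a₂) $
    product≢0 (adjacency G b₁ b₂) _ (Adj⇒≢0 G b₁~b₂) $
    product≢0 (1 ∸ adjacency G a₁ b₂) _ (¬Adj⇒1∸adjacency≢0 a₁≁b₂) $
    product≢0 (1 ∸ adjacency G b₁ a₂) _ (¬Adj⇒1∸adjacency≢0 b₁≁a₂) $
    product≢0 _ _ (a₁≢b₂ ∘ m∸n+n∸m≡0⇒m≡n a₁ b₂) (b₁≢a₂ ∘ m∸n+n∸m≡0⇒m≡n b₁ a₂)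
    where open IsProper p

  mirror : Tuple n → Tuple n
  mirror ⟨ a₁ , a₂ , b₁ , b₂ ⟩ = ⟨ a₂ , a₁ , b₂ , b₁ ⟩

  Represents : Tuple n → (a₁ a₂ b₁ b₂ : ℕ) → Set
  Represents q a₁ a₂ b₁ b₂ =
    toℕ (Tuple.a₁ q) ≡ a₁ × toℕ (Tuple.a₂ q) ≡ a₂ × toℕ (Tuple.b₁ q) ≡ b₁ × toℕ (Tuple.b₂ q) ≡ b₂

  represented : ∀ {a₁ a₂ b₁ b₂} → IsProper a₁ a₂ b₁ b₂ → ∃[ q ] Represents q a₁ a₂ b₁ b₂
  represented p with Adj⇒~ G (IsProper.a₁~a₂ p) | Adj⇒~ G (IsProper.b₁~b₂ p)
  ... | a₁ , a₂ , a₁≡ , a₂≡ , _ | b₁ , b₂ , b₁≡ , b₂≡ , _ =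
    ⟨ a₁ , a₂ , b₁ , b₂ ⟩ , a₁≡ , a₂≡ , b₁≡ , b₂≡

  Adj-sym : ∀ {i j} → Adj G i j → Adj G j i
  Adj-sym a with Adj⇒~ G a
  ... | _ , _ , refl , refl , x~y = ~⇒Adj G (~-sym x~y)

  -- The remaining inequalities follow: adjacent vertices differ, and `a₁ ≡ b₁` or `a₂ ≡ b₂` would
  -- turn an edge into one of the two non-edges.
  proper : ∀ {q a₁ a₂ b₁ b₂} → Represents q a₁ a₂ b₁ b₂ → IsProper a₁ a₂ b₁ b₂ → Proper G q
  proper (refl , refl , refl , refl) p = record
    { a₁≢b₁ = λ { refl → b₁≁a₂ a₁~a₂ }
    ; a₁≢a₂ = λ { refl → irrefl refl (~⇐Adj a₁~a₂) }
    ; a₁≢b₂ = a₁≢b₂ ∘ cong toℕ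
    ; b₁≢a₂ = b₁≢a₂ ∘ cong toℕ
    ; b₁≢b₂ = λ { refl → irrefl refl (~⇐Adj b₁~b₂) }
    ; a₂≢b₂ = λ { refl → a₁≁b₂ a₁~a₂ }
    ; a₁~a₂ = ~⇐Adj a₁~a₂
    ; b₁~b₂ = ~⇐Adj b₁~b₂
    ; a₁≁b₂ = a₁≁b₂ ∘ ~⇒Adj G
    ; b₁≁a₂ = b₁≁a₂ ∘ ~⇒Adj G
    }
    where
    open IsProper p
    ~⇐Adj : ∀ {x y} → Adj G (toℕ x) (toℕ y) → x ~ y
    ~⇐Adj a with Adj⇒~ G a
    ... | _ , _ , x≡ , y≡ , x~y = subst₂ _~_ (toℕ-injective x≡) (toℕ-injective y≡) x~y

  mirror-proper : ∀ {q} → Proper G q → Proper G (mirror q)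
  mirror-proper p = record
    { a₁≢b₁ = a₂≢b₂
    ; a₁≢a₂ = a₁≢a₂ ∘ sym
    ; a₁≢b₂ = b₁≢a₂ ∘ sym
    ; b₁≢a₂ = a₁≢b₂ ∘ sym
    ; b₁≢b₂ = b₁≢b₂ ∘ sym
    ; a₂≢b₂ = a₁≢b₁
    ; a₁~a₂ = ~-sym a₁~a₂
    ; b₁~b₂ = ~-sym b₁~b₂
    ; a₁≁b₂ = b₁≁a₂ ∘ ~-sym
    ; b₁≁a₂ = a₁≁b₂ ∘ ~-sym
    }
    where open Proper p

  emitted : (a₁ a₂ b₁ b₂ : ℕ) → List (Tuple n)
  emitted a₁ a₂ b₁ b₂ with properness a₁ a₂ b₁ b₂ ≟ 0
  ... | yes _  = []
  ... | no ≢0  = q ∷ mirror q ∷ []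
    where q = proj₁ (represented (properness≢0⇒IsProper a₁ a₂ b₁ b₂ ≢0))

  emitted-proper : ∀ a₁ a₂ b₁ b₂ → All (Proper G) (emitted a₁ a₂ b₁ b₂)
  emitted-proper a₁ a₂ b₁ b₂ with properness a₁ a₂ b₁ b₂ ≟ 0
  ... | yes _  = []
  ... | no ≢0  = q-proper ∷ mirror-proper q-proper ∷ []
    where
    p = properness≢0⇒IsProper a₁ a₂ b₁ b₂ ≢0
    q-proper = proper (proj₂ (represented p)) p

  length-emitted : ∀ a₁ a₂ b₁ b₂ → length (emitted a₁ a₂ b₁ b₂) ≤ 2
  length-emitted a₁ a₂ b₁ b₂ with properness a₁ a₂ b₁ b₂ ≟ 0
  ... | yes _  = z≤n
  ... | no _   = ≤-refl

  -- Couples the emitted list with the outcome of the test, so that both can be abstracted together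
  -- in later case distinctions.
  data EmitView (a₁ a₂ b₁ b₂ : ℕ) : List (Tuple n) → Set where
    rejected : properness a₁ a₂ b₁ b₂ ≡ 0 → EmitView a₁ a₂ b₁ b₂ []
    accepted : properness a₁ a₂ b₁ b₂ ≢ 0 → ∀ q → Represents q a₁ a₂ b₁ b₂ →
               EmitView a₁ a₂ b₁ b₂ (q ∷ mirror q ∷ [])

  emitView : ∀ a₁ a₂ b₁ b₂ → EmitView a₁ a₂ b₁ b₂ (emitted a₁ a₂ b₁ b₂)
  emitView a₁ a₂ b₁ b₂ with properness a₁ a₂ b₁ b₂ ≟ 0
  ... | yes ≡0 = rejected ≡0
  ... | no ≢0  = accepted ≢0 _ (proj₂ (represented (properness≢0⇒IsProper a₁ a₂ b₁ b₂ ≢0)))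

-- Functional semantics of the loop language

record Config (n : ℕ) : Set where
  constructor config
  field
    regs  : ℕ → ℕ
    cells : ℕ → ℕ → ℕ
    found : List (Tuple n)

open Config

toState : ∀ {n} → Config n → State
toState κ = state (regs κ) (cells κ) (encode (found κ))

module _ {n : ℕ} (G : Graph n) where

  value : Config n → Expr → ℕ
  value κ e = eval G (toState κ) e

  setReg : ℕ → ℕ → Config n → Config n
  setReg x k κ = record κ { regs = regs κ [ x ↦ k ] }

  -- Here the output is still a list of tuples. A loop is iterated `n` times without consulting its
  -- guard; that the compiled guard agrees is part of `exec`.
  run  : Prog → Config n → Config n
  step : ℕ → Prog → Config n → Config n

  run (set x e)           κ = setReg x (value κ e) κ
  run (put a d e)         κ =
    record κ { cells = cells κ [ a ↦ cells κ a [ value κ d ↦ value κ e ] ] }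
  run (emit a₁ a₂ b₁ b₂) κ =
    record κ { found = found κ ++ emitted G (value κ a₁) (value κ a₂) (value κ b₁) (value κ b₂) }
  run (c ▸ d)             κ = run d (run c κ)
  run (when e c)          κ = branch (value κ e) κ (run c κ)
  run (for x c)           κ =
    iterate n (step x c) (setReg x 0 κ)

  step x c κ = setReg x (regs (run c κ) x + 1) (run c κ)

  Bounded : ℕ → Config n → Set
  Bounded B κ = (∀ x → regs κ x ≤ B) × (∀ a i → cells κ a i ≤ B)

  Bounded-mono : ∀ {B B′ κ} → B ≤ B′ → Bounded B κ → Bounded B′ κ
  Bounded-mono B≤B′ (rs , cs) = (λ x → ≤-trans (rs x) B≤B′) , (λ a i → ≤-trans (cs a i) B≤B′)

  upd≤ : ∀ {f : ℕ → ℕ} {B} i {k} → (∀ j → f j ≤ B) → k ≤ B → ∀ j → (f [ i ↦ k ]) j ≤ B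
  upd≤ i f≤B k≤B j with does (i ≟ j)
  ... | true  = k≤B
  ... | false = f≤B j

  upd₂≤ : ∀ {f : ℕ → ℕ → ℕ} {B} a i {k} → (∀ b j → f b j ≤ B) → k ≤ B →
          ∀ b j → (f [ a ↦ f a [ i ↦ k ] ]) b j ≤ B
  upd₂≤ a i f≤B k≤B b j with does (a ≟ b)
  ... | true  = upd≤ i (f≤B a) k≤B j
  ... | false = f≤B b j

  small≤ : ∀ {B κ} e → Small e → Bounded B κ → value κ e ≤ B + 1
  small≤ {B} (const 0) _ _ = z≤n
  small≤ {B} (const 1) _ _ = m≤n+m 1 B
  small≤ {B} (var x) _ (rs , _) = ≤-trans (rs x) (m≤m+n B 1)
  small≤ {B} (arr a e) _ (_ , cs) = ≤-trans (cs a _) (m≤m+n B 1)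
  small≤ (var x ⊕ const 1) _ (rs , _) = +-monoˡ-≤ 1 (rs x)
  small≤ (arr a e ⊕ const 1) _ (_ , cs) = +-monoˡ-≤ 1 (cs a _)

  frame-regs : ∀ c y κ → sets c y ≡ false → regs (run c κ) y ≡ regs κ y
  frame-regs (set x e) y κ eq rewrite eq = refl
  frame-regs (put a d e) y κ eq = refl
  frame-regs (emit _ _ _ _) y κ eq = refl
  frame-regs (c ▸ d) y κ eq with sets c y in eq₁
  ... | false = trans (frame-regs d y (run c κ) eq) (frame-regs c y κ eq₁)
  frame-regs (when e c) y κ eq with value κ e
  ... | zero  = refl
  ... | suc _ = frame-regs c y κ eq
  frame-regs (for x c) y κ eq with does (x ≟ y) in eq₁
  ... | false = trans (go n (setReg x 0 κ)) (setReg-other 0 κ)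
    where
    setReg-other : ∀ k κ → regs (setReg x k κ) y ≡ regs κ y
    setReg-other k κ = cong (λ b → if b then k else regs κ y) eq₁
    go : ∀ k κ → regs (iterate k (step x c) κ) y ≡ regs κ y
    go zero    κ = refl
    go (suc k) κ = trans (go k _) (trans (setReg-other _ (run c κ)) (frame-regs c y κ eq))

  frame-cells : ∀ c a κ → puts c a ≡ false → cells (run c κ) a ≡ cells κ a
  frame-cells (set x e) b κ eq = refl
  frame-cells (put a d e) b κ eq rewrite eq = refl
  frame-cells (emit _ _ _ _) b κ eq = refl
  frame-cells (c ▸ d) b κ eq with puts c b in eq₁
  ... | false = trans (frame-cells d b (run c κ) eq) (frame-cells c b κ eq₁)
  frame-cells (when e c) b κ eq with value κ e
  ... | zero  = refl
  ... | suc _ = frame-cells c b κ eq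
  frame-cells (for x c) b κ eq = go n (setReg x 0 κ)
    where
    go : ∀ k κ → cells (iterate k (step x c) κ) b ≡ cells κ b
    go zero    κ = refl
    go (suc k) κ = trans (go k _) (frame-cells c b κ eq)

  -- Expressions cannot read the output. This is needed because each of the eight writes of an
  -- emission is evaluated after the output has grown.
  eval-out : ∀ {v a o} o′ e → eval G (state v a o) e ≡ eval G (state v a o′) e
  eval-out o′ (const k) = refl
  eval-out o′ (var x)   = refl
  eval-out {a = a} o′ (arr b e) = cong (a b) (eval-out o′ e)
  eval-out o′ (adj d e) = cong₂ (adjacency G) (eval-out o′ d) (eval-out o′ e)
  eval-out o′ (d ⊕ e)   = cong₂ _+_ (eval-out o′ d) (eval-out o′ e)
  eval-out o′ (d ⊖ e)   = cong₂ _∸_ (eval-out o′ d) (eval-out o′ e)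
  eval-out o′ (d ⊗ e)   = cong₂ _*_ (eval-out o′ d) (eval-out o′ e)

  Fits : ℕ → State → Expr → Set
  Fits W σ e = eval G σ e ≤ W

  exec-writes : ∀ {W v a} o es → All (Fits W (state v a [])) es →
    Exec G W (writes es) (state v a o) (state v a (o ++ map (eval G (state v a [])) es)) (writes-cost es)
  exec-writes {W} {v} {a} o [] [] =
    subst (λ o′ → Exec G W skip (state v a o) (state v a o′) 1) (sym (++-identityʳ o)) skip
  exec-writes {W} {v} {a} o (e ∷ es) (e≤W ∷ es≤W) = seq (write (subst (_≤ W) (sym eq) e≤W)) rest
    where
    eq : eval G (state v a o) e ≡ eval G (state v a []) e
    eq = eval-out [] e
    rest : Exec G W (writes es) (state v a (o ∷ʳ eval G (state v a o) e))
             (state v a (o ++ map (eval G (state v a [])) (e ∷ es))) (writes-cost es)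
    rest rewrite eq | sym (++-assoc o (eval G (state v a []) e ∷ []) (map (eval G (state v a [])) es)) =
      exec-writes (o ∷ʳ eval G (state v a []) e) es es≤W

-- Simulation on the machine, with bounds on time and numbers

module _ {n : ℕ} (G : Graph n) where

  Adj⇒< : ∀ {i j} → Adj G i j → i < n × j < n
  Adj⇒< a with Adj⇒~ G a
  ... | x , y , refl , refl , _ = toℕ<n x , toℕ<n y

  encode-mirrored : ∀ {v a a₁ a₂ b₁ b₂} {e₁ e₂ e₃ e₄} U q → Represents G q a₁ a₂ b₁ b₂ →
    eval G (state v a []) e₁ ≡ a₁ → eval G (state v a []) e₂ ≡ a₂ →
    eval G (state v a []) e₃ ≡ b₁ → eval G (state v a []) e₄ ≡ b₂ →
    encode U ++ map (eval G (state v a [])) (mirrored e₁ e₂ e₃ e₄) ≡ encode (U ++ q ∷ mirror G q ∷ [])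
  encode-mirrored U q (refl , refl , refl , refl) eq₁ eq₂ eq₃ eq₄
    rewrite eq₁ | eq₂ | eq₃ | eq₄ = sym (concatMap-++ _ U (q ∷ mirror G q ∷ []))

  -- The bound on memory grows by the time bound: each assignment or store costs at least one step
  -- and raises the maximum by at most one.
  Halts : ℕ → Prog → ℕ → Config n → Set
  Halts W c B κ = ∃[ t ] Exec G W (compile c) (toState κ) (toState (run G c κ)) t
    × t ≤ time c n × Bounded G (B + time c n) (run G c κ)

  -- Numbers are written only after the test has shown them to be ends of edges. They are thus below
  -- n, which fits into a word because it is the content of register 0.
  exec-emit : ∀ {W B} e₁ e₂ e₃ e₄ κ → regs κ 0 ≡ n → Bounded G B κ → B ≤ W →
    Halts W (emit e₁ e₂ e₃ e₄) B κ
  exec-emit {W} {B} e₁ e₂ e₃ e₄ κ r₀ bd B≤W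
    with emitted G (value G κ e₁) (value G κ e₂) (value G κ e₃) (value G κ e₄)
       | emitView G (value G κ e₁) (value G κ e₂) (value G κ e₃) (value G κ e₄)
  ... | .[] | rejected ≡0 =
    _ , subst (λ U → Exec G W (compile (emit e₁ e₂ e₃ e₄)) (toState κ)
                             (state (regs κ) (cells κ) (encode U)) _)
              (sym (++-identityʳ (found κ))) (cond-false ≡0 skip)
      , s≤s (+-monoʳ-≤ (cost (properᵉ e₁ e₂ e₃ e₄)) (s≤s z≤n))
      , Bounded-mono G {κ = κ} (m≤m+n B _) bd
  ... | _ | accepted ≢0 q rep =
    _ , cond-true ≢0 (subst (λ o → Exec G W _ _ (state (regs κ) (cells κ) o) _)
          (encode-mirrored {e₁ = e₁} {e₂} {e₃} {e₄} (found κ) q rep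
             (eval-out G _ e₁) (eval-out G _ e₂) (eval-out G _ e₃) (eval-out G _ e₄))
          (exec-writes G (encode (found κ)) (mirrored e₁ e₂ e₃ e₄)
            (f₁ ∷ f₂ ∷ f₃ ∷ f₄ ∷ f₂ ∷ f₁ ∷ f₄ ∷ f₃ ∷ [])))
      , ≤-refl
      , Bounded-mono G {κ = κ} (m≤m+n B _) bd
    where
    p = properness≢0⇒IsProper G _ _ _ _ ≢0
    fits : ∀ e → value G κ e < n → Fits G W (state (regs κ) (cells κ) []) e
    fits e e<n = ≤-trans (≤-reflexive (eval-out G _ e))
      (≤-trans (<⇒≤ e<n) (≤-trans (≤-trans (≤-reflexive (sym r₀)) (proj₁ bd 0)) B≤W))
    f₁ = fits e₁ (proj₁ (Adj⇒< (IsProper.a₁~a₂ p)))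
    f₂ = fits e₂ (proj₂ (Adj⇒< (IsProper.a₁~a₂ p)))
    f₃ = fits e₃ (proj₁ (Adj⇒< (IsProper.b₁~b₂ p)))
    f₄ = fits e₄ (proj₂ (Adj⇒< (IsProper.b₁~b₂ p)))

  round-assoc : ∀ B S R → B + (S + R + 4) ≡ B + S + (R + 4)
  round-assoc B S R = trans (cong (B +_) (+-assoc S R 4)) (sym (+-assoc B S (R + 4)))

  counter≤ : ∀ B S {x κ} → Bounded G (B + S) κ → regs κ x + 1 ≤ B + (S + 8)
  counter≤ B S {x} (rs , _) = ≤-trans (+-mono-≤ (rs x) (s≤s z≤n)) (≤-reflexive (+-assoc B S 8))

  -- Register 0 must keep its value n, since every compiled guard compares the counter with it.
  exec : ∀ {W} c {B} κ → WellFormed c → sets c 0 ≡ false → regs κ 0 ≡ n →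
    Bounded G B κ → B + time c n ≤ W → Halts W c B κ

  -- Induction on the number `j` of rounds left, for all `B`: each round hands an increased memory
  -- bound to the next.
  exec-while : ∀ {W} c x {B} κ j → T (not (sets c x)) → WellFormed c →
    sets c 0 ≡ false → x ≢ 0 → regs κ 0 ≡ n → regs κ x + j ≡ n →
    Bounded G B κ → B + (j * (time c n + 8) + 4) ≤ W →
    let κ⁺ = iterate j (step G x c) κ in
    ∃[ t ] Exec G W (while (var 0 ⊖ var x) (compile c ⨾ x ≔ var x ⊕ const 1)) (toState κ) (toState κ⁺) t
      × t ≤ j * (time c n + 8) + 4 × Bounded G (B + (j * (time c n + 8) + 4)) κ⁺

  exec (set x e) {B} κ small _ _ bd B≤W =
    _ , assign (≤-trans e≤ B≤W) , ≤-refl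
      , upd≤ G x (λ y → ≤-trans (proj₁ bd y) (m≤m+n B _)) e≤
      , λ a i → ≤-trans (proj₂ bd a i) (m≤m+n B _)
    where
    e≤ = ≤-trans (small≤ G {κ = κ} e small bd) (+-monoʳ-≤ B (s≤s (z≤n {cost e})))
  exec (put a d e) {B} κ (small-d , small-e) _ _ bd B≤W =
    _ , store (≤-trans (small⇒≤ d small-d) B≤W) (≤-trans (small⇒≤ e small-e) B≤W) , ≤-refl
      , (λ y → ≤-trans (proj₁ bd y) (m≤m+n B _))
      , upd₂≤ G a (value G κ d) (λ b i → ≤-trans (proj₂ bd b i) (m≤m+n B _)) (small⇒≤ e small-e)
    where
    small⇒≤ : ∀ e′ → Small e′ → value G κ e′ ≤ B + suc (cost d + cost e)
    small⇒≤ e′ small = ≤-trans (small≤ G {κ = κ} e′ small bd) (+-monoʳ-≤ B (s≤s z≤n))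
  exec (emit e₁ e₂ e₃ e₄) {B} κ _ _ r₀ bd B≤W = exec-emit e₁ e₂ e₃ e₄ κ r₀ bd (m+n≤o⇒m≤o B B≤W)
  exec {W} (c ▸ d) {B} κ (wf-c , wf-d) eq r₀ bd B≤W
    with ∨-false {sets c 0} eq
  ... | eq-c , eq-d
    with exec c κ wf-c eq-c r₀ bd (≤-trans (+-monoʳ-≤ B (m≤m+n (time c n) (time d n))) B≤W)
  ... | s , ex-c , s≤ , bd-c
    with exec d (run G c κ) wf-d eq-d (trans (frame-regs G c 0 κ eq-c) r₀) bd-c
           (subst (_≤ W) (sym (+-assoc B (time c n) (time d n))) B≤W)
  ... | t , ex-d , t≤ , bd-d =
    s + t , seq ex-c ex-d , +-mono-≤ s≤ t≤
      , subst (λ B → Bounded G B (run G d (run G c κ))) (+-assoc B (time c n) (time d n)) bd-d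
  exec {W} (when e c) {B} κ wf eq r₀ bd B≤W with value G κ e in eq-e
  ... | zero  = _ , cond-false eq-e skip , s≤s (+-monoʳ-≤ (cost e) (s≤s z≤n))
      , Bounded-mono G {κ = κ} (m≤m+n B _) bd
  ... | suc _ with exec c κ wf eq r₀ bd (≤-trans (+-monoʳ-≤ B c≤) B≤W)
    where
    c≤ : time c n ≤ suc (cost e + suc (time c n))
    c≤ = m≤n⇒m≤1+n (≤-trans (n≤1+n _) (m≤n+m _ (cost e)))
  ...   | t , ex , t≤ , bd′ =
    _ , cond-true (λ ≡0 → 0≢1+n (trans (sym ≡0) eq-e)) ex
      , s≤s (+-monoʳ-≤ (cost e) (m≤n⇒m≤1+n t≤))
      , Bounded-mono G {κ = run G c κ}
          (+-monoʳ-≤ B (m≤n⇒m≤1+n (≤-trans (n≤1+n _) (m≤n+m _ (cost e))))) bd′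
  exec {W} (for x c) {B} κ (wf-x , wf) eq r₀ bd B≤W with ∨-false {does (x ≟ 0)} eq
  ... | eq-x , eq-c
    with exec-while c x (setReg G x 0 κ) n wf-x wf eq-c x≢0
           (trans (upd-other (regs κ) 0 x≢0) r₀) (cong (_+ n) (upd-same (regs κ) x 0))
           (upd≤ G x (proj₁ bd) z≤n , proj₂ bd)
           (≤-trans (+-monoʳ-≤ B (m≤n+m _ 2)) B≤W)
    where x≢0 = does≟-false eq-x
  ... | t , ex , t≤ , bd′ =
    _ , seq (assign z≤n) ex , +-monoʳ-≤ 2 t≤
      , Bounded-mono G {κ = run G (for x c) κ} (+-monoʳ-≤ B (m≤n+m _ 2)) bd′

  exec-while c x {B} κ zero _ _ _ _ r₀ r≡n bd _ =
    _ , while-false (m≤n⇒m∸n≡0 (≤-reflexive (trans r₀ (trans (sym r≡n) (+-identityʳ _)))))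
      , ≤-refl , Bounded-mono G {κ = κ} (m≤m+n B 4) bd
  exec-while {W} c x {B} κ (suc j) wf-x wf eq x≢0 r₀ r≡n bd B≤W
    with exec c κ wf eq r₀ bd (≤-trans (+-monoʳ-≤ B c≤) B≤W)
    where
    c≤ : time c n ≤ suc j * (time c n + 8) + 4
    c≤ = ≤-trans (m≤m+n (time c n) 8) (≤-trans (m≤m+n _ (j * (time c n + 8))) (m≤m+n _ 4))
  ... | s , ex-c , s≤ , bd-c
    with exec-while c x {B + (time c n + 8)} (step G x c κ) j wf-x wf eq x≢0
           (trans (upd-other (regs κ′) _ x≢0) (trans (frame-regs G c 0 κ eq) r₀))
           r≡n′ bd′ (subst (_≤ W) (round-assoc B (time c n + 8) _) B≤W)
    where
    κ′ = run G c κ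
    r≡n′ : regs (step G x c κ) x + j ≡ n
    r≡n′ = begin
      regs (step G x c κ) x + j ≡⟨ cong (_+ j) (upd-same (regs κ′) x _) ⟩
      regs κ′ x + 1 + j         ≡⟨ +-assoc (regs κ′ x) 1 j ⟩
      regs κ′ x + suc j         ≡⟨ cong (_+ suc j) (frame-regs G c x κ (not-T wf-x)) ⟩
      regs κ x + suc j          ≡⟨ r≡n ⟩
      n                         ∎
      where open ≡-Reasoning
    bd′ : Bounded G (B + (time c n + 8)) (step G x c κ)
    bd′ = upd≤ G x (λ y → ≤-trans (proj₁ bd-c y) (+-monoʳ-≤ B (m≤m+n _ 8))) (counter≤ B (time c n) {κ = run G c κ} bd-c)
        , (λ a i → ≤-trans (proj₂ bd-c a i) (+-monoʳ-≤ B (m≤m+n _ 8)))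
  ... | t , ex , t≤ , bd″ =
    _ , while-true guard (seq ex-c (assign r≤W)) ex , total≤
      , subst (λ B → Bounded G B (iterate j (step G x c) (step G x c κ)))
              (sym (round-assoc B (time c n + 8) _)) bd″
    where
    guard : regs κ 0 ∸ regs κ x ≢ 0
    guard = m>n⇒m∸n≢0 (subst (regs κ x <_) (trans r≡n (sym r₀)) (m<m+n (regs κ x) (s≤s z≤n)))
    r≤W : regs (run G c κ) x + 1 ≤ W
    r≤W = ≤-trans (counter≤ B (time c n) {κ = run G c κ} bd-c)
      (≤-trans (m≤m+n _ (j * (time c n + 8) + 4)) (subst (_≤ W) (round-assoc B (time c n + 8) _) B≤W))
    open ≤-Reasoning
    total≤ : suc (3 + (s + 4 + t)) ≤ suc j * (time c n + 8) + 4
    total≤ = begin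
      4 + (s + 4 + t)
        ≡⟨ solve 2 (λ s t → con 4 :+ (s :+ con 4 :+ t) := s :+ con 8 :+ t) refl s t ⟩
      s + 8 + t
        ≤⟨ +-mono-≤ (+-monoˡ-≤ 8 s≤) t≤ ⟩
      time c n + 8 + (j * (time c n + 8) + 4)
        ≡⟨ +-assoc (time c n + 8) _ 4 ⟨
      suc j * (time c n + 8) + 4 ∎
      where
      open +-*-Solver

-- Counting outputs, and a rule for loop invariants

outputs : Prog → ℕ → ℕ
outputs (set _ _)      n = 0
outputs (put _ _ _)    n = 0
outputs (emit _ _ _ _) n = 2
outputs (c ▸ d)        n = outputs c n + outputs d n
outputs (when _ c)     n = outputs c n
outputs (for _ c)      n = n * outputs c n

module _ {n : ℕ} (G : Graph n) where

  record Extends (m : ℕ) (U U′ : List (Tuple n)) : Set where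
    field
      added   : List (Tuple n)
      U′≡     : U′ ≡ U ++ added
      propers : All (Proper G) added
      length≤ : length added ≤ m

  extends-refl : ∀ {m U} → Extends m U U
  extends-refl {U = U} = record
    { added = [] ; U′≡ = sym (++-identityʳ U) ; propers = [] ; length≤ = z≤n }

  extends-trans : ∀ {l m U U′ U″} → Extends l U U′ → Extends m U′ U″ → Extends (l + m) U U″
  extends-trans {U = U} e e′ = record
    { added   = E.added ++ E′.added
    ; U′≡ = trans E′.U′≡ (trans (cong (_++ E′.added) E.U′≡) (++-assoc U E.added E′.added))
    ; propers = ++⁺ E.propers E′.propers
    ; length≤ = ≤-trans (≤-reflexive (length-++ E.added)) (+-mono-≤ E.length≤ E′.length≤)
    }
    where module E = Extends e
          module E′ = Extends e′

  run-extends : ∀ c κ → Extends (outputs c n) (found κ) (found (run G c κ))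
  iterate-extends : ∀ c x k κ → Extends (k * outputs c n) (found κ) (found (iterate k (step G x c) κ))

  run-extends (set x e) κ = extends-refl
  run-extends (put a d e) κ = extends-refl
  run-extends (emit e₁ e₂ e₃ e₄) κ = record
    { U′≡ = refl
    ; propers = emitted-proper G v₁ v₂ v₃ v₄
    ; length≤ = length-emitted G v₁ v₂ v₃ v₄
    }
    where
    v₁ = value G κ e₁
    v₂ = value G κ e₂
    v₃ = value G κ e₃
    v₄ = value G κ e₄
  run-extends (c ▸ d) κ = extends-trans (run-extends c κ) (run-extends d (run G c κ))
  run-extends (when e c) κ with value G κ e
  ... | zero  = extends-refl
  ... | suc _ = run-extends c κ
  run-extends (for x c) κ = iterate-extends c x n (setReg G x 0 κ)

  iterate-extends c x zero    κ = extends-refl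
  iterate-extends c x (suc k) κ =
    extends-trans (run-extends c κ) (iterate-extends c x k (step G x c κ))

  found-⊆ : ∀ c κ → found κ ⊆ found (run G c κ)
  found-⊆ c κ q∈ = subst (_ ∈_) (sym U′≡) (∈-++⁺ˡ q∈)
    where open Extends (run-extends c κ)

  record Frame (c : Prog) (κ κ′ : Config n) : Set where
    field
      regs-≡  : ∀ y → sets c y ≡ false → regs κ′ y ≡ regs κ y
      cells-≡ : ∀ a → puts c a ≡ false → cells κ′ a ≡ cells κ a

  -- The `Frame` compares with the state before the loop, so that facts about registers and arrays
  -- which the body does not change stay out of the invariant `P`.
  for-invariant : ∀ x c κ (P : ℕ → Config n → Set) → sets c x ≡ false →
    P 0 (setReg G x 0 κ) →
    (∀ {i} κ′ → i < n → regs κ′ x ≡ i → Frame (for x c) κ κ′ → P i κ′ → P (suc i) (step G x c κ′)) →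
    P n (run G (for x c) κ)
  for-invariant x c κ P x∉c P₀ P-step =
    go n 0 (setReg G x 0 κ) (+-identityʳ n) (upd-same (regs κ) x 0) frame₀ P₀
    where
    frame₀ : Frame (for x c) κ (setReg G x 0 κ)
    frame₀ = record
      { regs-≡ = λ y eq → upd-other (regs κ) 0 (does≟-false {x} {y} (proj₁ (∨-false {does (x ≟ y)} eq)))
      ; cells-≡ = λ a eq → refl }
    frame-step : ∀ {κ′} → Frame (for x c) κ κ′ → Frame (for x c) κ (step G x c κ′)
    frame-step {κ′} fr = record
      { regs-≡ = λ y eq → let x≠y , y∉c = ∨-false {does (x ≟ y)} eq in
          trans (upd-other (regs (run G c κ′)) _ (does≟-false {x} {y} x≠y))
            (trans (frame-regs G c y κ′ y∉c) (Frame.regs-≡ fr y eq))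
      ; cells-≡ = λ a eq → trans (frame-cells G c a κ′ eq) (Frame.cells-≡ fr a eq) }
    go : ∀ k i κ′ → k + i ≡ n → regs κ′ x ≡ i → Frame (for x c) κ κ′ → P i κ′ →
         P n (iterate k (step G x c) κ′)
    go zero    i κ′ refl _ _ p = p
    go (suc k) i κ′ k+i≡n r≡i fr p =
      go k (suc i) (step G x c κ′) (trans (+-suc k i) k+i≡n) r≡ (frame-step fr)
         (P-step κ′ (≤-trans (s≤s (m≤n+m i k)) (≤-reflexive k+i≡n)) r≡i fr p)
      where
      r≡ : regs (step G x c κ′) x ≡ suc i
      r≡ = trans (upd-same (regs (run G c κ′)) x _)
             (trans (cong (_+ 1) (trans (frame-regs G c x κ′ x∉c) r≡i)) (+-comm i 1))

  when-elim : ∀ e c κ (P : Config n → Set) → (value G κ e ≡ 0 → P κ) →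
    (value G κ e ≢ 0 → P (run G c κ)) → P (run G (when e c) κ)
  when-elim e c κ P f t with value G κ e
  ... | zero  = f refl
  ... | suc _ = t λ ()

-- Breadth-first search

levels parents labels mergeFrom mergeTo : ℕ
levels    = 0
parents   = 1
labels    = 2
mergeFrom = 3
mergeTo   = 4

newlyReached : Expr
newlyReached = (arr levels (var 2) ==ᵉ var 1 ⊕ const 1) ⊗ (notᵉ (arr levels (var 3)) ⊗ adj (var 2) (var 3))

-- Levels count from 1 for the root, and 0 marks the vertices not yet reached.
reach : Prog
reach = put levels (var 3) (arr levels (var 2) ⊕ const 1) ▸ put parents (var 3) (var 2)

-- Round k, in register 1, looks at all pairs of vertices and extends level k + 1 to level k + 2. It
-- takes quadratic time, and n rounds are enough by `level≤n`.
bfs : Prog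
bfs = put levels (const 0) (const 1)
    ▸ for 1 (for 2 (for 3 (when newlyReached reach)))

==ᵉ⇒≡ : ∀ a b → 1 ∸ ((a ∸ b) + (b ∸ a)) ≢ 0 → a ≡ b
==ᵉ⇒≡ a b ≢0 = m∸n+n∸m≡0⇒m≡n a b (1∸m≢0⇒m≡0 _ ≢0)

≡⇒==ᵉ : ∀ a → 1 ∸ ((a ∸ a) + (a ∸ a)) ≢ 0
≡⇒==ᵉ a ≡0 with () ← trans (sym (cong (1 ∸_) (m∸m+m∸m≡0 a))) ≡0

module _ {n : ℕ} (G : Graph n) where
  open Graph G using (_~_)

  record Reached (d p : ℕ → ℕ) (y : ℕ) : Set where
    field
      edge    : Adj G (p y) y
      level   : d y ≡ suc (d (p y))
      reached : d (p y) ≢ 0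

  -- The pair of `x`, on level `l`, and `y` has had its turn when the loop counters are `k`, `u`,
  -- `v`: lower levels are finished, and pairs starting on level `suc k` are taken in lexicographic
  -- order.
  Scanned : (k u v x y l : ℕ) → Set
  Scanned k u v x y l = l ≤ k ⊎ (l ≡ suc k × (x < u ⊎ (x ≡ u × y < v)))

  record Layered (k u v : ℕ) (d p : ℕ → ℕ) : Set where
    field
      root   : d 0 ≡ 1
      parent : ∀ y → d y ≢ 0 → y ≢ 0 → Reached d p y
      level≤ : ∀ y → d y ≤ 2 + k
      closed : ∀ x y → Adj G x y → d x ≢ 0 → Scanned k u v x y (d x) → d y ≢ 0 × d y ≤ suc (d x)

  layered-start : ∀ {p} → Layered 0 0 0 ((λ _ → 0) [ 0 ↦ 1 ]) p
  layered-start = record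
    { root   = refl
    ; parent = λ { zero _ 0≢0 → ⊥-elim (0≢0 refl) ; (suc y) ≢0 _ → ⊥-elim (≢0 refl) }
    ; level≤ = λ { zero → s≤s z≤n ; (suc y) → z≤n }
    ; closed = λ { zero y _ _ (inj₁ ()) ; zero y _ _ (inj₂ (_ , inj₁ ())) ; zero y _ _ (inj₂ (_ , inj₂ (_ , ())))
                 ; (suc x) y _ ≢0 _ → ⊥-elim (≢0 refl) }
    }

  layered-weaken : ∀ {k u v u′ v′ d p} →
    (∀ {x y l} → Adj G x y → Scanned k u′ v′ x y l → Scanned k u v x y l) →
    Layered k u v d p → Layered k u′ v′ d p
  layered-weaken f L = record
    { root = root ; parent = parent ; level≤ = level≤
    ; closed = λ x y x~y ≢0 sc → closed x y x~y ≢0 (f x~y sc) }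
    where open Layered L

  next-u : ∀ {k u x y l} → Adj G x y → Scanned k (suc u) 0 x y l → Scanned k u n x y l
  next-u _ (inj₁ l≤k) = inj₁ l≤k
  next-u x~y (inj₂ (l≡ , inj₁ (s≤s x≤u))) with m≤n⇒m<n∨m≡n x≤u
  ... | inj₁ x<u = inj₂ (l≡ , inj₁ x<u)
  ... | inj₂ x≡u = inj₂ (l≡ , inj₂ (x≡u , proj₂ (Adj⇒< G x~y)))

  next-k : ∀ {k d p} → Layered k n 0 d p → Layered (suc k) 0 0 d p
  next-k {k} L = record
    { root = root ; parent = parent
    ; level≤ = λ y → m≤n⇒m≤1+n (level≤ y)
    ; closed = λ { x y x~y ≢0 (inj₁ l≤) → closed x y x~y ≢0 (scan l≤ x~y)
                 ; x y _ _ (inj₂ (_ , inj₁ ())) ; x y _ _ (inj₂ (_ , inj₂ (_ , ()))) } }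
    where
    open Layered L
    scan : ∀ {x y l} → l ≤ suc k → Adj G x y → Scanned k n 0 x y l
    scan l≤ x~y with m≤n⇒m<n∨m≡n l≤
    ... | inj₁ (s≤s l≤k) = inj₁ l≤k
    ... | inj₂ l≡        = inj₂ (l≡ , inj₁ (proj₁ (Adj⇒< G x~y)))

  next-v : ∀ {k u v x y l} → Scanned k u (suc v) x y l → Scanned k u v x y l ⊎ (l ≡ suc k × x ≡ u × y ≡ v)
  next-v (inj₁ l≤k)              = inj₁ (inj₁ l≤k)
  next-v (inj₂ (l≡ , inj₁ x<u)) = inj₁ (inj₂ (l≡ , inj₁ x<u))
  next-v (inj₂ (l≡ , inj₂ (x≡u , s≤s y≤v))) with m≤n⇒m<n∨m≡n y≤v
  ... | inj₁ y<v = inj₁ (inj₂ (l≡ , inj₂ (x≡u , y<v)))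
  ... | inj₂ y≡v = inj₂ (l≡ , x≡u , y≡v)

  -- If `v` already has a level, then this is at most `2 + k`, one more than the level of `u`.
  layered-skip : ∀ {k u v d p} → (d u ≡ suc k → d v ≡ 0 → ¬ Adj G u v) →
    Layered k u v d p → Layered k u (suc v) d p
  layered-skip {k} {u} {v} {d} {p} skipped L = record
    { root = root ; parent = parent ; level≤ = level≤ ; closed = closed′ }
    where
    open Layered L
    closed′ : ∀ x y → Adj G x y → d x ≢ 0 → Scanned k u (suc v) x y (d x) → d y ≢ 0 × d y ≤ suc (d x)
    closed′ x y x~y ≢0 sc with next-v sc
    ... | inj₁ sc′ = closed x y x~y ≢0 sc′
    ... | inj₂ (l≡ , refl , refl) =
      (λ dy≡0 → skipped l≡ dy≡0 x~y) , ≤-trans (level≤ y) (≤-reflexive (cong suc (sym l≡)))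

  -- Only `v` changes, and it was unreached, so everything known about reached vertices, the root
  -- among them, survives.
  layered-reach : ∀ {k u v d p} → d u ≡ suc k → d v ≡ 0 → Adj G u v →
    Layered k u v d p → Layered k u (suc v) (d [ v ↦ d u + 1 ]) (p [ v ↦ u ])
  layered-reach {k} {u} {v} {d} {p} du≡ dv≡0 u~v L = record
    { root = trans (d′-old 0≢v) root ; parent = parent′ ; level≤ = level≤′ ; closed = closed′ }
    where
    open Layered L
    d′ = d [ v ↦ d u + 1 ]
    p′ = p [ v ↦ u ]
    old : ∀ {y} → d y ≢ 0 → v ≢ y
    old dy≢0 refl = dy≢0 dv≡0
    0≢v : v ≢ 0
    0≢v = old (λ d0≡0 → 1+n≢0 (trans (sym root) d0≡0))
    d′-old : ∀ {y} → v ≢ y → d′ y ≡ d y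
    d′-old = upd-other d _
    d′-new : d′ v ≡ 2 + k
    d′-new = trans (upd-same d v _) (trans (+-comm (d u) 1) (cong suc du≡))
    d′-kept : ∀ {y} → d y ≢ 0 → d′ y ≡ d y
    d′-kept = d′-old ∘ old
    du≢0 : d u ≢ 0
    du≢0 du≡0 = 1+n≢0 (trans (sym du≡) du≡0)
    d′≢0 : ∀ {y} → d y ≢ 0 → d′ y ≢ 0
    d′≢0 dy≢0 = dy≢0 ∘ trans (sym (d′-kept dy≢0))
    via : ∀ {a y} → p′ y ≡ a → Adj G a y → d′ y ≡ suc (d′ a) → d′ a ≢ 0 → Reached d′ p′ y
    via refl a~y dy≡ da≢0 = record { edge = a~y ; level = dy≡ ; reached = da≢0 }
    parent′ : ∀ y → d′ y ≢ 0 → y ≢ 0 → Reached d′ p′ y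
    parent′ y ≢0 y≢0 with v ≟ y
    ... | yes refl = via (upd-same p v u) u~v
                       (trans d′-new (cong suc (sym (trans (d′-kept du≢0) du≡)))) (d′≢0 du≢0)
    ... | no v≢y   = via (upd-other p u v≢y) edge
                       (trans (d′-old v≢y) (trans level (cong suc (sym (d′-kept reached))))) (d′≢0 reached)
      where open Reached (parent y (≢0 ∘ trans (d′-old v≢y)) y≢0)
    level≤′ : ∀ y → d′ y ≤ 2 + k
    level≤′ y with v ≟ y
    ... | yes refl = ≤-reflexive d′-new
    ... | no v≢y   = ≤-trans (≤-reflexive (d′-old v≢y)) (level≤ y)
    closed-old : ∀ x y → Adj G x y → d x ≢ 0 → Scanned k u (suc v) x y (d x) → d′ y ≢ 0 × d′ y ≤ suc (d x)
    closed-old x y x~y ≢0 sc with next-v sc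
    ... | inj₂ (l≡ , refl , refl) =
      (λ d′y≡0 → 1+n≢0 (trans (sym d′-new) d′y≡0)) , ≤-reflexive (trans d′-new (cong suc (sym l≡)))
    ... | inj₁ sc′ with closed x y x~y ≢0 sc′
    ...   | dy≢0 , dy≤ = d′≢0 dy≢0 , ≤-trans (≤-reflexive (d′-kept dy≢0)) dy≤
    scanned≤ : ∀ {x y l} → Scanned k u (suc v) x y l → l ≤ suc k
    scanned≤ (inj₁ l≤k)      = m≤n⇒m≤1+n l≤k
    scanned≤ (inj₂ (l≡ , _)) = ≤-reflexive l≡
    closed′ : ∀ x y → Adj G x y → d′ x ≢ 0 → Scanned k u (suc v) x y (d′ x) →
              d′ y ≢ 0 × d′ y ≤ suc (d′ x)
    closed′ x y x~y ≢0 sc with v ≟ x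
    -- The new vertex is on level `2 + k`, from which no pair has been scanned.
    ... | yes refl = ⊥-elim (1+n≰n (≤-trans (≤-reflexive (sym d′-new)) (scanned≤ {x} {y} sc)))
    ... | no v≢x   = subst (λ l → d′ y ≢ 0 × d′ y ≤ suc l) (sym (d′-old v≢x))
      (closed-old x y x~y (≢0 ∘ trans (d′-old v≢x)) (subst (Scanned k u (suc v) x y) (d′-old v≢x) sc))

  newlyReached-eval : ∀ κ → value G κ newlyReached ≢ 0 →
    cells κ levels (regs κ 2) ≡ suc (regs κ 1) × cells κ levels (regs κ 3) ≡ 0 × Adj G (regs κ 2) (regs κ 3)
  newlyReached-eval κ ≢0 =
      trans (==ᵉ⇒≡ _ _ (factorˡ≢0 (value G κ (arr levels (var 2) ==ᵉ var 1 ⊕ const 1)) _ ≢0)) (+-comm _ 1)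
    , 1∸m≢0⇒m≡0 _ (factorˡ≢0 (value G κ (notᵉ (arr levels (var 3)))) _ ≢0₁)
    , adjacency≢0⇒Adj G _ _ (factorʳ≢0 (value G κ (notᵉ (arr levels (var 3)))) _ ≢0₁)
    where
    ≢0₁ = factorʳ≢0 (value G κ (arr levels (var 2) ==ᵉ var 1 ⊕ const 1)) _ ≢0

  newlyReached-intro : ∀ κ → cells κ levels (regs κ 2) ≡ suc (regs κ 1) →
    cells κ levels (regs κ 3) ≡ 0 → Adj G (regs κ 2) (regs κ 3) → value G κ newlyReached ≢ 0
  newlyReached-intro κ du≡ dv≡0 u~v =
    product≢0 _ _ (subst (λ l → 1 ∸ ((l ∸ (regs κ 1 + 1)) + ((regs κ 1 + 1) ∸ l)) ≢ 0)
                     (sym (trans du≡ (+-comm 1 _))) (≡⇒==ᵉ (regs κ 1 + 1))) $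
    product≢0 _ _ (λ ≡0 → 1+n≢0 (trans (sym (cong (1 ∸_) dv≡0)) ≡0)) (Adj⇒≢0 G u~v)

  LayeredAt : (k u v : ℕ) → Config n → Set
  LayeredAt k u v κ = Layered k u v (cells κ levels) (cells κ parents)

  bfs-layered : ∀ κ → cells κ ≡ (λ _ _ → 0) → LayeredAt n 0 0 (run G bfs κ)
  bfs-layered (config r _ U) refl =
    for-invariant G 1 loop₂ κ₁ (λ k → LayeredAt k 0 0) refl layered-start λ {k} κ₂ k<n r₁ _ L →
      next-k (for-invariant G 2 loop₃ κ₂ (λ u → LayeredAt k u 0) refl L λ {u} κ₃ u<n r₂ fr₂ L →
        layered-weaken next-u (for-invariant G 3 body κ₃ (LayeredAt k u) refl L λ {v} κ₄ v<n r₃ fr₃ L →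
          visit κ₄ (trans (Frame.regs-≡ fr₃ 1 refl) (trans (Frame.regs-≡ fr₂ 1 refl) r₁))
            (trans (Frame.regs-≡ fr₃ 2 refl) r₂) r₃ L))
    where
    κ₁ = run G (put levels (const 0) (const 1)) (config r (λ _ _ → 0) U)
    body = when newlyReached reach
    loop₃ = for 3 body
    loop₂ = for 2 loop₃
    visit : ∀ {k u v} κ → regs κ 1 ≡ k → regs κ 2 ≡ u → regs κ 3 ≡ v →
            LayeredAt k u v κ → LayeredAt k u (suc v) (run G body κ)
    visit κ refl refl refl L = when-elim G newlyReached reach κ (LayeredAt _ _ _)
      (λ ≡0 → layered-skip (λ du≡ dv≡0 u~v → newlyReached-intro κ du≡ dv≡0 u~v ≡0) L)
      (λ ≢0 → let du≡ , dv≡0 , u~v = newlyReached-eval κ ≢0 in layered-reach du≡ dv≡0 u~v L)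

  record BFSTree (d p : ℕ → ℕ) : Set where
    field
      parent~ : ∀ {y} → y < n → y ≢ 0 → Adj G (p y) y
      level   : ∀ {y} → y < n → y ≢ 0 → d y ≡ suc (d (p y))
      closed  : ∀ {x y} → Adj G x y → d y ≤ suc (d x)

  module _ {d p : ℕ → ℕ} (0<n : 0 < n) (L : Layered n 0 0 d p) where
    open Layered L

    reached⇒< : ∀ {y} → d y ≢ 0 → y < n
    reached⇒< {zero}  _  = 0<n
    reached⇒< {suc y} ≢0 = proj₂ (Adj⇒< G (Reached.edge (parent (suc y) ≢0 1+n≢0)))

    -- The path of parents from `y` to the root passes through every lower level.
    attained : ∀ m y → d y ≡ suc m → ∀ j → j ≤ m → ∃[ z ] z < n × d z ≡ suc j
    attained m y dy≡ j j≤m with m≤n⇒m<n∨m≡n j≤m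
    ... | inj₂ refl = y , reached⇒< (λ ≡0 → 1+n≢0 (trans (sym dy≡) ≡0)) , dy≡
    attained (suc m) zero    dy≡ j j≤m | inj₁ _ with () ← trans (sym root) dy≡
    attained (suc m) (suc y) dy≡ j j≤m | inj₁ (s≤s j≤m′) =
      attained m (p (suc y)) (suc-injective (trans (sym level) dy≡)) j j≤m′
      where open Reached (parent (suc y) (λ ≡0 → 1+n≢0 (trans (sym dy≡) ≡0)) 1+n≢0)

    -- A higher level would entail n + 1 occupied levels, but there are only n vertices. Hence after
    -- n rounds every edge at a reached vertex has been scanned.
    level≤n : ∀ y → d y ≤ n
    level≤n y with d y in dy≡
    ... | zero  = z≤n
    ... | suc m with m <? n
    ...   | yes m<n = m<n
    ...   | no m≮n  = ⊥-elim (collision (pigeonhole (n<1+n n) vertex))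
      where
      at : (i : Fin (suc n)) → ∃[ z ] z < n × d z ≡ suc (toℕ i)
      at i = attained m y dy≡ (toℕ i) (≤-trans (s≤s⁻¹ (toℕ<n i)) (≮⇒≥ m≮n))
      vertex : Fin (suc n) → Fin n
      vertex i = fromℕ< (proj₁ (proj₂ (at i)))
      collision : ∃[ i ] ∃[ j ] (toℕ i < toℕ j × vertex i ≡ vertex j) → ⊥
      collision (i , j , i<j , eq) = <⇒≢ i<j (suc-injective (begin
        suc (toℕ i)        ≡⟨ proj₂ (proj₂ (at i)) ⟨
        d (proj₁ (at i))   ≡⟨ cong d (toℕ-fromℕ< _) ⟨
        d (toℕ (vertex i)) ≡⟨ cong (d ∘ toℕ) eq ⟩
        d (toℕ (vertex j)) ≡⟨ cong d (toℕ-fromℕ< _) ⟩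
        d (proj₁ (at j))   ≡⟨ proj₂ (proj₂ (at j)) ⟩
        suc (toℕ j)        ∎))
        where open ≡-Reasoning

    reach-along : ∀ {x y} → d (toℕ x) ≢ 0 → Star _~_ x y → d (toℕ y) ≢ 0
    reach-along ≢0 ε            = ≢0
    reach-along ≢0 (x~z ◅ path) =
      reach-along (proj₁ (closed _ _ (~⇒Adj G x~z) ≢0 (inj₁ (level≤n _)))) path

    layered⇒BFSTree : Connected G → BFSTree d p
    layered⇒BFSTree conn = record
      { parent~ = λ y<n y≢0 → Reached.edge (parent _ (reached y<n) y≢0)
      ; level   = λ y<n y≢0 → Reached.level (parent _ (reached y<n) y≢0)
      ; closed  = λ x~y → proj₂ (closed _ _ x~y (reached (proj₁ (Adj⇒< G x~y))) (inj₁ (level≤n _)))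
      }
      where
      reached : ∀ {y} → y < n → d y ≢ 0
      reached {y} y<n = subst (λ y → d y ≢ 0) (toℕ-fromℕ< y<n)
        (reach-along (λ ≡0 → 1+n≢0 (trans (sym root) (trans (cong d (sym (toℕ-fromℕ< 0<n))) ≡0)))
               (Connected.path conn (fromℕ< 0<n) (fromℕ< y<n)))

-- Spanning forests

-- The test of candidates (2) for the tree edge of the vertex in register 1.
keptᵉ : Expr → Expr → Expr
keptᵉ x y = adj x y ⊗ (notᵉ (adj a x ⊗ adj b y) ⊗ notᵉ (adj a y ⊗ adj b x))
  where
  a = arr parents (var 1)
  b = var 1

-- Register 2 holds the vertex being inserted and register 3 an earlier one. By the last factor,
-- each old component is joined only through the first kept edge that is met.
joins : Expr
joins = (var 2 ⊖ var 3) ⊗ (keptᵉ (var 3) (var 2) ⊗ notᵉ (arr mergeTo (arr labels (var 3))))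

join : Prog
join = put mergeFrom (arr labels (var 3)) (var 3) ▸ put mergeTo (arr labels (var 3)) (var 2)

merged : Expr
merged = (var 2 ⊖ var 3) ⊗ (arr mergeTo (arr labels (var 3)) ==ᵉ var 2)

relabel : Prog
relabel = put labels (var 3) (var 2)

-- Vertices are inserted one by one and carry the label of their component.
-- When a label c disappears because of the edge uv, the entry c of mergeFrom
-- and mergeTo becomes u and v.  Entry 0 of mergeTo means that c is still alive
-- (or was never used), which is unambiguous since the inserted vertex v is
-- never 0 when there is something to merge.
forest : Prog
forest = for 2 (put mergeTo (var 2) (const 0))
       ▸ for 2 (put labels (var 2) (var 2) ▸ for 3 (when joins join) ▸ for 3 (when merged relabel))

-- The colouring `s` is arbitrary, and the goal is the cut property `crossing`. Throughout, `l`, `f`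
-- and `t` stand for `labels`, `mergeFrom` and `mergeTo`.
module Merging (n : ℕ) (Kept : ℕ → ℕ → Set) (s : ℕ → Bool) where

  Crossed : (f t : ℕ → ℕ) → Set
  Crossed f t = ∃[ c ] c < n × t c ≢ 0 × Kept (f c) (t c) × s (f c) ≢ s (t c)

  -- The alternative to `Crossed`: components have a single colour, namely that of their label, and
  -- no kept edge among the first `w` vertices crosses.
  Respected : ℕ → (ℕ → ℕ) → Set
  Respected w l = (∀ {x} → x < w → s (l x) ≡ s x) × (∀ {x y} → x < y → y < w → Kept x y → s x ≡ s y)

  record Merged (w : ℕ) (l f t : ℕ → ℕ) : Set where
    field
      label< : ∀ {x} → x < w → l x < w
      alive  : ∀ {x} → x < w → t (l x) ≡ 0
      past   : ∀ {c} → c < n → t c ≡ 0 ⊎ t c < w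
      fresh  : ∀ {c} → w ≤ c → c < n → t c ≡ 0
      cut    : Crossed f t ⊎ Respected w l

  -- The labels of earlier vertices still describe the components before the insertion of `w`. An
  -- entry `w` in `t` marks a component to be merged, and `witness` gives the edge responsible for
  -- it.
  record Joining (w u : ℕ) (l f t : ℕ → ℕ) : Set where
    field
      own     : l w ≡ w
      label<  : ∀ {x} → x < w → l x < w
      status  : ∀ {x} → x < w → t (l x) ≡ 0 ⊎ t (l x) ≡ w
      joined  : ∀ {x} → x < u → x < w → Kept x w → t (l x) ≡ w
      witness : ∀ {c} → c < w → t c ≡ w → f c < w × l (f c) ≡ c × Kept (f c) w
      past    : ∀ {c} → c < n → t c ≡ 0 ⊎ t c < suc w
      fresh   : ∀ {c} → w ≤ c → c < n → t c ≡ 0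
      cut     : Crossed f t ⊎ Respected w l

  -- The merged component takes the label `w`. That marked components have the colour of `w` is kept
  -- in `cut`, so that the new labels have the right colours too.
  record Relabelling (w u : ℕ) (l f t : ℕ → ℕ) : Set where
    field
      own    : l w ≡ w
      label≤ : ∀ {x} → x < w → l x ≤ w
      status : ∀ {x} → x < w → t (l x) ≡ 0 ⊎ t (l x) ≡ w
      done   : ∀ {x} → x < u → x < w → t (l x) ≡ 0
      past   : ∀ {c} → c < n → t c ≡ 0 ⊎ t c < suc w
      fresh  : ∀ {c} → w ≤ c → c < n → t c ≡ 0
      cut    : Crossed f t ⊎ (Respected (suc w) l × (∀ {x} → x < w → t (l x) ≡ w → s x ≡ s w))

  merged-start : ∀ {l f t} → (∀ {c} → c < n → t c ≡ 0) → Merged 0 l f t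
  merged-start t≡0 = record
    { label< = λ () ; alive = λ () ; past = λ c<n → inj₁ (t≡0 c<n) ; fresh = λ _ → t≡0 ; cut = inj₂ ((λ ()) , λ _ ()) }

  insert : ∀ {w l f t} → w < n → Merged w l f t → Joining w 0 (l [ w ↦ w ]) f t
  insert {w} {l} {f} {t} w<n M = record
    { own     = upd-same l w w
    ; label<  = λ x<w → ≤-trans (≤-reflexive (cong suc (l′≡l x<w))) (label< x<w)
    ; status  = λ x<w → inj₁ (trans (cong t (l′≡l x<w)) (alive x<w))
    ; joined  = λ ()
    ; witness = λ c<w tc≡w → ⊥-elim (w≢t c<w tc≡w)
    ; past    = past-suc ∘ past
    ; fresh   = fresh
    ; cut     = respected cut
    }
    where
    open Merged M
    l′≡l : ∀ {x} → x < w → (l [ w ↦ w ]) x ≡ l x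
    l′≡l x<w = upd-other l w (<⇒≢ x<w ∘ sym)
    respected : Crossed f t ⊎ Respected w l → Crossed f t ⊎ Respected w (l [ w ↦ w ])
    respected (inj₁ crossed)    = inj₁ crossed
    respected (inj₂ (sl , sk)) = inj₂ ((λ x<w → trans (cong s (l′≡l x<w)) (sl x<w)) , sk)
    -- Earlier marks are smaller than `w`, and an empty entry could be mistaken for a mark only if
    -- `w` were 0, when there is no smaller `c`.
    w≢t : ∀ {c} → c < w → t c ≡ w → ⊥
    w≢t {c} c<w tc≡w with past (<-trans c<w w<n)
    ... | inj₁ tc≡0 = n≮0 (subst (c <_) (trans (sym tc≡w) tc≡0) c<w)
    ... | inj₂ tc<w = <⇒≢ tc<w tc≡w
    past-suc : ∀ {k} → k ≡ 0 ⊎ k < w → k ≡ 0 ⊎ k < suc w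
    past-suc (inj₁ k≡0) = inj₁ k≡0
    past-suc (inj₂ k<w) = inj₂ (m≤n⇒m≤1+n k<w)

  <-suc : ∀ {x u} → x < suc u → x < u ⊎ x ≡ u
  <-suc = m≤n⇒m<n∨m≡n ∘ s≤s⁻¹

  join-skip : ∀ {w u l f t} → (u < w → Kept u w → t (l u) ≢ 0) →
    Joining w u l f t → Joining w (suc u) l f t
  join-skip {w} {u} {l} {f} {t} skipped J = record
    { own = own ; label< = label< ; status = status ; joined = joined′
    ; witness = witness ; past = past ; fresh = fresh ; cut = cut }
    where
    open Joining J
    joined′ : ∀ {x} → x < suc u → x < w → Kept x w → t (l x) ≡ w
    joined′ x<1+u x<w kept with <-suc x<1+u
    ... | inj₁ x<u = joined x<u x<w kept
    ... | inj₂ refl with status x<w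
    ...   | inj₁ ≡0 = ⊥-elim (skipped x<w kept ≡0)
    ...   | inj₂ ≡w = ≡w

  -- Entry `i` is still empty, so the crossing edge is recorded elsewhere and is not overwritten.
  crossed-kept : ∀ {f t i u w} → t i ≡ 0 → Crossed f t → Crossed (f [ i ↦ u ]) (t [ i ↦ w ])
  crossed-kept {f} {t} {i} {u} {w} ti≡0 (c , c<n , tc≢0 , kept , s≢) =
    c , c<n , subst (_≢ 0) (sym tc) tc≢0 , subst₂ Kept (sym fc) (sym tc) kept
      , subst₂ (λ a b → s a ≢ s b) (sym fc) (sym tc) s≢
    where
    i≢c : i ≢ c
    i≢c refl = tc≢0 ti≡0
    fc = upd-other f u i≢c
    tc = upd-other t w i≢c

  join-record : ∀ {w u l f t} → u < w → Kept u w → t (l u) ≡ 0 →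
    Joining w u l f t → Joining w (suc u) l (f [ l u ↦ u ]) (t [ l u ↦ w ])
  join-record {w} {u} {l} {f} {t} u<w kept tlu≡0 J = record
    { own = own ; label< = label< ; status = status′ ; joined = joined′
    ; witness = witness′ ; past = past′ ; fresh = fresh′ ; cut = cut′ cut }
    where
    open Joining J
    f′ = f [ l u ↦ u ]
    t′ = t [ l u ↦ w ]
    status′ : ∀ {x} → x < w → t′ (l x) ≡ 0 ⊎ t′ (l x) ≡ w
    status′ {x} x<w with l u ≟ l x
    ... | yes lu≡lx = inj₂ (subst (λ c → t′ c ≡ w) lu≡lx (upd-same t (l u) w))
    ... | no lu≢lx  = subst (λ k → k ≡ 0 ⊎ k ≡ w) (sym (upd-other t w lu≢lx)) (status x<w)
    joined′ : ∀ {x} → x < suc u → x < w → Kept x w → t′ (l x) ≡ w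
    joined′ {x} x<1+u x<w kept-x with l u ≟ l x
    ... | yes lu≡lx = subst (λ c → t′ c ≡ w) lu≡lx (upd-same t (l u) w)
    ... | no lu≢lx with <-suc x<1+u
    ...   | inj₁ x<u  = trans (upd-other t w lu≢lx) (joined x<u x<w kept-x)
    ...   | inj₂ refl = ⊥-elim (lu≢lx refl)
    witness′ : ∀ {c} → c < w → t′ c ≡ w → f′ c < w × l (f′ c) ≡ c × Kept (f′ c) w
    witness′ {c} c<w t′c≡w with l u ≟ c
    ... | yes refl = subst (λ x → x < w × l x ≡ c × Kept x w) (sym (upd-same f (l u) u)) (u<w , refl , kept)
    ... | no lu≢c  = subst (λ x → x < w × l x ≡ c × Kept x w) (sym (upd-other f u lu≢c))
                       (witness c<w (trans (sym (upd-other t w lu≢c)) t′c≡w))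
    past′ : ∀ {c} → c < n → t′ c ≡ 0 ⊎ t′ c < suc w
    past′ {c} c<n with l u ≟ c
    ... | yes refl = inj₂ (s≤s (≤-reflexive (upd-same t (l u) w)))
    ... | no lu≢c  = subst (λ k → k ≡ 0 ⊎ k < suc w) (sym (upd-other t w lu≢c)) (past c<n)
    fresh′ : ∀ {c} → w ≤ c → c < n → t′ c ≡ 0
    fresh′ w≤c c<n = trans (upd-other t w (<⇒≢ (≤-trans (label< u<w) w≤c))) (fresh w≤c c<n)
    cut′ : Crossed f t ⊎ Respected w l → Crossed f′ t′ ⊎ Respected w l
    cut′ (inj₁ crossed)   = inj₁ (crossed-kept tlu≡0 crossed)
    cut′ (inj₂ respected) = inj₂ respected

  -- All marks are now set. Either one of the edges recorded for `w` crosses, or every marked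
  -- component, being of a single colour, has the colour of `w`. In the latter case no kept edge
  -- from an earlier vertex to `w` crosses, as it starts in a marked component by `joined`.
  start-relabelling : ∀ {w l f t} → w < n → Joining w n l f t → Relabelling w 0 l f t
  start-relabelling {w} {l} {f} {t} w<n J = record
    { own = own ; label≤ = <⇒≤ ∘ label< ; status = status ; done = λ () ; past = past ; fresh = fresh
    ; cut = cut′ cut }
    where
    open Joining J
    0<w : ∀ {c} → c < w → w ≢ 0
    0<w c<w refl = n≮0 c<w
    cut′ : Crossed f t ⊎ Respected w l →
           Crossed f t ⊎ (Respected (suc w) l × (∀ {x} → x < w → t (l x) ≡ w → s x ≡ s w))
    cut′ (inj₁ crossed) = inj₁ crossed
    cut′ (inj₂ (sl , sk)) with anyUpTo? (λ c → t c ≟ w ×-dec ¬? (s (f c) Bool.≟ s w)) w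
    ... | yes (c , c<w , refl , s≢) =
      inj₁ (c , <-trans c<w w<n , 0<w c<w , proj₂ (proj₂ (witness c<w refl)) , s≢)
    ... | no none = inj₂ ((sl′ , sk′) , same)
      where
      same : ∀ {x} → x < w → t (l x) ≡ w → s x ≡ s w
      same {x} x<w tlx≡w with witness (label< x<w) tlx≡w
      ... | u<w , lu≡lx , _ = begin
        s x               ≡⟨ sl x<w ⟨
        s (l x)           ≡⟨ cong s lu≡lx ⟨
        s (l (f (l x)))   ≡⟨ sl u<w ⟩
        s (f (l x))       ≡⟨ decidable-stable (s (f (l x)) Bool.≟ s w)
                               (λ s≢ → none (l x , label< x<w , tlx≡w , s≢)) ⟩
        s w               ∎
        where open ≡-Reasoning
      sl′ : ∀ {x} → x < suc w → s (l x) ≡ s x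
      sl′ x<1+w with <-suc x<1+w
      ... | inj₁ x<w  = sl x<w
      ... | inj₂ refl = cong s own
      sk′ : ∀ {x y} → x < y → y < suc w → Kept x y → s x ≡ s y
      sk′ x<y y<1+w kept with <-suc y<1+w
      ... | inj₁ y<w  = sk x<y y<w kept
      ... | inj₂ refl = same x<y (joined (<-trans x<y w<n) x<y kept)

  relabel-skip : ∀ {w u l f t} → (u < w → t (l u) ≢ w) →
    Relabelling w u l f t → Relabelling w (suc u) l f t
  relabel-skip {w} {u} {l} {f} {t} skipped R = record
    { own = own ; label≤ = label≤ ; status = status ; done = done′ ; past = past ; fresh = fresh ; cut = cut }
    where
    open Relabelling R
    done′ : ∀ {x} → x < suc u → x < w → t (l x) ≡ 0
    done′ x<1+u x<w with <-suc x<1+u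
    ... | inj₁ x<u = done x<u x<w
    ... | inj₂ refl with status x<w
    ...   | inj₁ ≡0 = ≡0
    ...   | inj₂ ≡w = ⊥-elim (skipped x<w ≡w)

  relabel-join : ∀ {w u l f t} → w < n → u < w → t (l u) ≡ w →
    Relabelling w u l f t → Relabelling w (suc u) (l [ u ↦ w ]) f t
  relabel-join {w} {u} {l} {f} {t} w<n u<w tlu≡w R = record
    { own    = trans (upd-other l w (<⇒≢ u<w)) own
    ; label≤ = label≤′
    ; status = status′
    ; done   = done′
    ; past   = past
    ; fresh  = fresh
    ; cut    = cut′ cut
    }
    where
    open Relabelling R
    l′ = l [ u ↦ w ]
    -- Label `w` is itself unmarked, so a relabelled vertex carries a label that is alive.
    tw≡0 = fresh (≤-refl {w}) w<n
    label≤′ : ∀ {x} → x < w → l′ x ≤ w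
    label≤′ {x} x<w with u ≟ x
    ... | yes refl = ≤-reflexive (upd-same l u w)
    ... | no u≢x   = ≤-trans (≤-reflexive (upd-other l w u≢x)) (label≤ x<w)
    status′ : ∀ {x} → x < w → t (l′ x) ≡ 0 ⊎ t (l′ x) ≡ w
    status′ {x} x<w with u ≟ x
    ... | yes refl = inj₁ (trans (cong t (upd-same l u w)) tw≡0)
    ... | no u≢x   = subst (λ c → t c ≡ 0 ⊎ t c ≡ w) (sym (upd-other l w u≢x)) (status x<w)
    done′ : ∀ {x} → x < suc u → x < w → t (l′ x) ≡ 0
    done′ {x} x<1+u x<w with u ≟ x
    ... | yes refl = trans (cong t (upd-same l u w)) tw≡0
    ... | no u≢x with <-suc x<1+u
    ...   | inj₁ x<u = trans (cong t (upd-other l w u≢x)) (done x<u x<w)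
    ...   | inj₂ x≡u = ⊥-elim (u≢x (sym x≡u))
    cut′ : Crossed f t ⊎ (Respected (suc w) l × (∀ {x} → x < w → t (l x) ≡ w → s x ≡ s w)) →
           Crossed f t ⊎ (Respected (suc w) l′ × (∀ {x} → x < w → t (l′ x) ≡ w → s x ≡ s w))
    cut′ (inj₁ crossed) = inj₁ crossed
    cut′ (inj₂ ((sl , sk) , same)) = inj₂ ((sl′ , sk) , same′)
      where
      sl′ : ∀ {x} → x < suc w → s (l′ x) ≡ s x
      sl′ {x} x<1+w with u ≟ x
      ... | yes refl = trans (cong s (upd-same l u w)) (sym (same u<w tlu≡w))
      ... | no u≢x   = trans (cong s (upd-other l w u≢x)) (sl x<1+w)
      same′ : ∀ {x} → x < w → t (l′ x) ≡ w → s x ≡ s w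
      same′ {x} x<w tl′x≡w with u ≟ x
      ... | yes refl = same u<w tlu≡w
      ... | no u≢x   = same x<w (trans (cong t (sym (upd-other l w u≢x))) tl′x≡w)

  inserted : ∀ {w l f t} → w < n → Relabelling w n l f t → Merged (suc w) l f t
  inserted {w} {l} {f} {t} w<n R = record
    { label< = label<′
    ; alive  = alive′
    ; past   = past
    ; fresh  = λ w<c → fresh (<⇒≤ w<c)
    ; cut    = cut′ cut
    }
    where
    open Relabelling R
    label<′ : ∀ {x} → x < suc w → l x < suc w
    label<′ x<1+w with <-suc x<1+w
    ... | inj₁ x<w  = s≤s (label≤ x<w)
    ... | inj₂ refl = s≤s (≤-reflexive own)
    alive′ : ∀ {x} → x < suc w → t (l x) ≡ 0
    alive′ x<1+w with <-suc x<1+w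
    ... | inj₁ x<w  = done (<-trans x<w w<n) x<w
    ... | inj₂ refl = trans (cong t own) (fresh ≤-refl w<n)
    cut′ : Crossed f t ⊎ (Respected (suc w) l × (∀ {x} → x < w → t (l x) ≡ w → s x ≡ s w)) →
           Crossed f t ⊎ Respected (suc w) l
    cut′ (inj₁ crossed)         = inj₁ crossed
    cut′ (inj₂ (respected , _)) = inj₂ respected

  crossing : ∀ {l f t} → Merged n l f t → (∀ {x y} → Kept x y → x < n) → (∀ {x y} → Kept x y → Kept y x) →
    ∀ {x y} → Kept x y → s x ≢ s y → Crossed f t
  crossing M kept<n kept-sym {x} {y} kept s≢ with Merged.cut M
  ... | inj₁ crossed = crossed
  ... | inj₂ (_ , sk) with <-cmp x y
  ...   | tri< x<y _ _  = ⊥-elim (s≢ (sk x<y (kept<n (kept-sym kept)) kept))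
  ...   | tri≈ _ refl _ = ⊥-elim (s≢ refl)
  ...   | tri> _ _ y<x  = ⊥-elim (s≢ (sym (sk y<x (kept<n kept) (kept-sym kept))))

module _ {n : ℕ} (G : Graph n) where

  record Kept (a b x y : ℕ) : Set where
    field
      edge        : Adj G x y
      not-across  : ¬ (Adj G a x × Adj G b y)
      not-across′ : ¬ (Adj G a y × Adj G b x)

  kept-sym : ∀ {a b x y} → Kept a b x y → Kept a b y x
  kept-sym K = record { edge = Adj-sym G edge ; not-across = not-across′ ; not-across′ = not-across }
    where open Kept K

  keptValue : (a b x y : ℕ) → ℕ
  keptValue a b x y = adjacency G x y *
    ((1 ∸ adjacency G a x * adjacency G b y) * (1 ∸ adjacency G a y * adjacency G b x))

  1∸*≢0 : ∀ {i j k l} → 1 ∸ adjacency G i j * adjacency G k l ≢ 0 → ¬ (Adj G i j × Adj G k l)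
  1∸*≢0 ≢0 (ij , kl) = ≢0 (cong (1 ∸_) (cong₂ _*_ ij kl))

  ¬⇒1∸*≢0 : ∀ i j k l → ¬ (Adj G i j × Adj G k l) → 1 ∸ adjacency G i j * adjacency G k l ≢ 0
  ¬⇒1∸*≢0 i j k l ¬both ≡0 with adjacency-01 G i j | adjacency-01 G k l
  ... | inj₁ ij≡0 | _         = 1+n≢0 (trans (cong (λ m → 1 ∸ m * adjacency G k l) (sym ij≡0)) ≡0)
  ... | inj₂ ij   | inj₁ kl≡0 = 1+n≢0 (trans (cong₂ (λ l m → 1 ∸ l * m) (sym ij) (sym kl≡0)) ≡0)
  ... | inj₂ ij   | inj₂ kl   = ¬both (ij , kl)

  keptValue≢0⇒Kept : ∀ a b x y → keptValue a b x y ≢ 0 → Kept a b x y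
  keptValue≢0⇒Kept a b x y ≢0 = record
    { edge        = adjacency≢0⇒Adj G x y (factorˡ≢0 (adjacency G x y) _ ≢0)
    ; not-across  = 1∸*≢0 (factorˡ≢0 (1 ∸ adjacency G a x * adjacency G b y) _ ≢0₁)
    ; not-across′ = 1∸*≢0 (factorʳ≢0 (1 ∸ adjacency G a x * adjacency G b y) _ ≢0₁)
    }
    where ≢0₁ = factorʳ≢0 (adjacency G x y) _ ≢0

  Kept⇒keptValue≢0 : ∀ {a b x y} → Kept a b x y → keptValue a b x y ≢ 0
  Kept⇒keptValue≢0 {a} {b} {x} {y} K =
    product≢0 _ _ (Adj⇒≢0 G edge) $
    product≢0 _ _ (¬⇒1∸*≢0 a x b y not-across) (¬⇒1∸*≢0 a y b x not-across′)
    where open Kept K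

  m>n⇒∸≢0 : ∀ {m n} → m ∸ n ≢ 0 → n < m
  m>n⇒∸≢0 {m} {n} ≢0 = ≰⇒> (≢0 ∘ m≤n⇒m∸n≡0)

  module _ (s : ℕ → Bool) where

    KeptBy : Config n → ℕ → ℕ → Set
    KeptBy κ = Kept (cells κ parents (regs κ 1)) (regs κ 1)

    joins-intro : ∀ κ → let l = cells κ labels ; t = cells κ mergeTo ; u = regs κ 3 ; w = regs κ 2 in
      u < w → KeptBy κ u w → t (l u) ≡ 0 → value G κ joins ≢ 0
    joins-intro κ u<w kept tlu≡0 =
      product≢0 _ _ (m>n⇒m∸n≢0 u<w) $
      product≢0 _ _ (Kept⇒keptValue≢0 kept) (λ ≡0 → 1+n≢0 (trans (cong (1 ∸_) (sym tlu≡0)) ≡0))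

    joins-elim : ∀ κ → let l = cells κ labels ; t = cells κ mergeTo ; u = regs κ 3 ; w = regs κ 2 in
      value G κ joins ≢ 0 → u < w × KeptBy κ u w × t (l u) ≡ 0
    joins-elim κ ≢0 =
        m>n⇒∸≢0 (factorˡ≢0 (regs κ 2 ∸ regs κ 3) _ ≢0)
      , keptValue≢0⇒Kept _ _ _ _ (factorˡ≢0 (value G κ (keptᵉ (var 3) (var 2))) _ ≢0₁)
      , 1∸m≢0⇒m≡0 _ (factorʳ≢0 (value G κ (keptᵉ (var 3) (var 2))) _ ≢0₁)
      where ≢0₁ = factorʳ≢0 (regs κ 2 ∸ regs κ 3) _ ≢0

    module _ (a b : ℕ) where
      open Merging n (Kept a b) s

      On : ((l f t : ℕ → ℕ) → Set) → Config n → Set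
      On R κ = R (cells κ labels) (cells κ mergeFrom) (cells κ mergeTo)

      AtTreeEdge : Config n → Set
      AtTreeEdge κ = regs κ 1 ≡ b × cells κ parents b ≡ a

      atTreeEdge-frame : ∀ {c κ κ′} → sets c 1 ≡ false → puts c parents ≡ false →
        Frame G c κ κ′ → AtTreeEdge κ → AtTreeEdge κ′
      atTreeEdge-frame 1∉c p∉c fr (r₁ , pb≡a) =
          trans (Frame.regs-≡ fr 1 1∉c) r₁
        , trans (cong (λ p → p b) (Frame.cells-≡ fr parents p∉c)) pb≡a

      join-visit : ∀ {w u} κ → AtTreeEdge κ → regs κ 2 ≡ w → regs κ 3 ≡ u →
        On (Joining w u) κ → On (Joining w (suc u)) (run G (when joins join) κ)
      join-visit κ (refl , refl) refl refl J = when-elim G joins join κ (On (Joining _ _))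
        (λ ≡0 → join-skip (λ u<w kept tlu≡0 → joins-intro κ u<w kept tlu≡0 ≡0) J)
        (λ ≢0 → let u<w , kept , tlu≡0 = joins-elim κ ≢0 in join-record u<w kept tlu≡0 J)

      relabel-visit : ∀ {w u} κ → w < n → regs κ 2 ≡ w → regs κ 3 ≡ u →
        On (Relabelling w u) κ → On (Relabelling w (suc u)) (run G (when merged relabel) κ)
      relabel-visit κ w<n refl refl R = when-elim G merged relabel κ (On (Relabelling _ _))
        (λ ≡0 → relabel-skip (λ u<w tlu≡w → product≢0 _ _ (m>n⇒m∸n≢0 u<w)
                  (subst (λ k → 1 ∸ ((k ∸ w) + (w ∸ k)) ≢ 0) (sym tlu≡w) (≡⇒==ᵉ w)) ≡0) R)
        (λ ≢0 → relabel-join w<n (m>n⇒∸≢0 (factorˡ≢0 (w ∸ u) _ ≢0))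
                  (==ᵉ⇒≡ _ w (factorʳ≢0 (w ∸ u) _ ≢0)) R)
        where
        w = regs κ 2
        u = regs κ 3

      forest-merged : ∀ κ → AtTreeEdge κ → On (Merged n) (run G forest κ)
      forest-merged κ cur =
        for-invariant G 2 body κ₁ (λ w → On (Merged w)) refl (merged-start cleared) λ {w} κ₂ w<n r₂ fr M →
          let κ₃ = run G (put labels (var 2) (var 2)) κ₂
              κ₄ = run G (for 3 (when joins join)) κ₃
              cur₃ = atTreeEdge-frame {body₂} {κ₁} {κ₂} refl refl fr cur₁
          in inserted w<n
            (for-invariant G 3 (when merged relabel) κ₄ (λ u → On (Relabelling w u)) refl
              (start-relabelling w<n
                (for-invariant G 3 (when joins join) κ₃ (λ u → On (Joining w u)) refl
                  (subst (λ i → Joining w 0 (cells κ₂ labels [ i ↦ i ]) (cells κ₂ mergeFrom) (cells κ₂ mergeTo))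
                         (sym r₂) (insert w<n M))
                  λ κ₅ _ r₃ fr J → join-visit κ₅ (atTreeEdge-frame {for 3 (when joins join)} {κ₃} {κ₅} refl refl fr cur₃)
                    (trans (Frame.regs-≡ fr 2 refl) r₂) r₃ J))
              λ κ₅ _ r₃ fr R → relabel-visit κ₅ w<n
                (trans (Frame.regs-≡ fr 2 refl) (trans (frame-regs G (for 3 (when joins join)) 2 κ₃ refl) r₂)) r₃ R)
        where
        clear = for 2 (put mergeTo (var 2) (const 0))
        body = put labels (var 2) (var 2) ▸ for 3 (when joins join) ▸ for 3 (when merged relabel)
        body₂ = for 2 body
        κ₁ = run G clear κ
        cur₁ : AtTreeEdge κ₁
        cur₁ = trans (frame-regs G clear 1 κ refl) (proj₁ cur)
             , trans (cong (λ p → p b) (frame-cells G clear parents κ refl)) (proj₂ cur)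
        -- At this point the array may still hold the forest of the previous tree edge.
        cleared : ∀ {c} → c < n → cells κ₁ mergeTo c ≡ 0
        cleared = for-invariant G 2 (put mergeTo (var 2) (const 0)) κ
          (λ i κ′ → ∀ {c} → c < i → cells κ′ mergeTo c ≡ 0) refl (λ ())
          λ κ′ _ r₂ _ t≡0 → clear-visit κ′ r₂ t≡0
          where
          clear-visit : ∀ κ′ {i} → regs κ′ 2 ≡ i → (∀ {c} → c < i → cells κ′ mergeTo c ≡ 0) →
            ∀ {c} → c < suc i → (cells κ′ mergeTo [ regs κ′ 2 ↦ 0 ]) c ≡ 0
          clear-visit κ′ {i} refl t≡0 {c} c<1+i with <-suc c<1+i
          ... | inj₂ refl = upd-same (cells κ′ mergeTo) i 0
          ... | inj₁ c<i  = trans (upd-other (cells κ′ mergeTo) 0 (<⇒≢ c<i ∘ sym)) (t≡0 c<i)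

      forest-crossing : ∀ κ → AtTreeEdge κ → ∀ {x y} → Kept a b x y → s x ≢ s y →
        Crossed (cells (run G forest κ) mergeFrom) (cells (run G forest κ) mergeTo)
      forest-crossing κ cur =
        crossing (forest-merged κ cur) (λ K → proj₁ (Adj⇒< G (Kept.edge K))) kept-sym

-- The universal set

climbs : Expr
climbs = adj (var 2) (var 1) ⊗ (arr levels (var 2) ⊕ const 1 ==ᵉ arr levels (var 1))

-- Family (1); then (2) in both orientations, as it is unknown which end of a forest edge is on the
-- side of the parent; then (3) with the two consecutive neighbours in both roles.
emissions : Prog
emissions = emit (arr parents (var 1)) (var 1) (arr parents (var 2)) (var 2)
          ▸ emit (arr parents (var 1)) (var 1) (arr mergeFrom (var 2)) (arr mergeTo (var 2))
          ▸ emit (arr parents (var 1)) (var 1) (arr mergeTo (var 2)) (arr mergeFrom (var 2))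
          ▸ emit (arr parents (var 2)) (var 2) (var 4) (var 1)
          ▸ emit (arr parents (var 4)) (var 4) (var 2) (var 1)

-- Register 4 holds the last vertex on the level above that of register 1
-- which was found to be adjacent to it.
scan : Prog
scan = emissions ▸ when climbs (set 4 (var 2))

process : Prog
-- The initial value of register 4 is a placeholder: the invariant speaks of this register only once
-- a neighbour on the preceding level has been found.
process = forest ▸ set 4 (var 1) ▸ for 2 scan

universalSet : Prog
universalSet = bfs ▸ for 1 process

module _ {n : ℕ} (G : Graph n) (s : ℕ → Bool) where

  Emits : List (Tuple n) → (a₁ a₂ b₁ b₂ : ℕ) → Set
  Emits U a₁ a₂ b₁ b₂ = emitted G a₁ a₂ b₁ b₂ ⊆ U

  record Up (d : ℕ → ℕ) (v x : ℕ) : Set where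
    constructor up
    field
      edge  : Adj G x v
      level : suc (d x) ≡ d v

  up? : ∀ d v x → Dec (Up d v x)
  up? d v x with adjacency G x v ≟ 1 | suc (d x) ≟ d v
  ... | yes e | yes l = yes (up e l)
  ... | no ¬e | _     = no (¬e ∘ Up.edge)
  ... | yes _ | no ¬l = no (¬l ∘ Up.level)

  module _ (d p : ℕ → ℕ) (v : ℕ) where

    Climbed : List (Tuple n) → Set
    Climbed U = ∃[ x ] ∃[ y ] Up d v x × Up d v y × s x ≢ s y
      × Emits U (p x) x y v × Emits U (p y) y x v

    -- As long as no two consecutive upper neighbours of `v` are on different sides, all those found
    -- are on the side of `last`; this is the second case of `climb`.
    record Scanning (f t : ℕ → ℕ) (i last : ℕ) (U : List (Tuple n)) : Set where
      field
        trees : ∀ {c} → c < i → Emits U (p v) v (p c) c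
        edges : ∀ {c} → c < i → Emits U (p v) v (f c) (t c) × Emits U (p v) v (t c) (f c)
        climb : Climbed U ⊎ (∀ {x} → x < i → Up d v x → Up d v last × s x ≡ s last)

    -- The next vertex overwrites the arrays of the forest, so `crosses` records their effect in
    -- terms of the output alone.
    record Processed (U : List (Tuple n)) : Set where
      field
        trees   : ∀ {c} → c < n → Emits U (p v) v (p c) c
        crosses : ∀ {x y} → Kept G (p v) v x y → s x ≢ s y →
                  ∃[ x′ ] ∃[ y′ ] Kept G (p v) v x′ y′ × s x′ ≢ s y′
                    × Emits U (p v) v x′ y′ × Emits U (p v) v y′ x′
        climb   : ∀ {x y} → Up d v x → Up d v y → s x ≢ s y → Climbed U

    climbed-mono : ∀ {U U′} → U ⊆ U′ → Climbed U → Climbed U′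
    climbed-mono U⊆ (x , y , ux , uy , s≢ , e , e′) = x , y , ux , uy , s≢ , U⊆ ∘ e , U⊆ ∘ e′

    processed-mono : ∀ {U U′} → U ⊆ U′ → Processed U → Processed U′
    processed-mono U⊆ P = record
      { trees   = λ c<n → U⊆ ∘ trees c<n
      ; crosses = λ K s≢ → let x , y , K′ , s≢′ , e , e′ = crosses K s≢ in
                           x , y , K′ , s≢′ , U⊆ ∘ e , U⊆ ∘ e′
      ; climb   = λ ux uy s≢ → climbed-mono U⊆ (climb ux uy s≢) }
      where open Processed P

    processed : ∀ {f t last U} → Scanning f t n last U →
      (∀ {x y} → Kept G (p v) v x y → s x ≢ s y → Merging.Crossed n (Kept G (p v) v) s f t) →
      Processed U
    processed {f} {t} {last} {U} S crossing = record
      { trees   = trees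
      ; crosses = λ K s≢ → let c , c<n , _ , K′ , s≢′ = crossing K s≢ in
                           f c , t c , K′ , s≢′ , edges c<n
      ; climb   = climbed climb }
      where
      open Scanning S
      climbed : Climbed U ⊎ (∀ {x} → x < n → Up d v x → Up d v last × s x ≡ s last) →
        ∀ {x y} → Up d v x → Up d v y → s x ≢ s y → Climbed U
      climbed (inj₁ c) _ _ _ = c
      climbed (inj₂ same) ux uy s≢ = ⊥-elim (s≢ (trans (same-side ux) (sym (same-side uy))))
        where
        same-side : ∀ {x} → Up d v x → s x ≡ s last
        same-side ux = proj₂ (same (proj₁ (Adj⇒< G (Up.edge ux))) ux)

    record EmittedAt (f t : ℕ → ℕ) (i last : ℕ) (U : List (Tuple n)) : Set where
      field
        tree  : Emits U (p v) v (p i) i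
        edge  : Emits U (p v) v (f i) (t i)
        edge′ : Emits U (p v) v (t i) (f i)
        pair  : Emits U (p i) i last v
        pair′ : Emits U (p last) last i v

    module _ {f t : ℕ → ℕ} {i last : ℕ} {U U′ : List (Tuple n)} (U⊆ : U ⊆ U′)
             (E : EmittedAt f t i last U′) (S : Scanning f t i last U) where
      open EmittedAt E
      open Scanning S

      trees′ : ∀ {c} → c < suc i → Emits U′ (p v) v (p c) c
      trees′ c<1+i with m<1+n⇒m<n∨m≡n c<1+i
      ... | inj₁ c<i  = U⊆ ∘ trees c<i
      ... | inj₂ refl = tree

      edges′ : ∀ {c} → c < suc i → Emits U′ (p v) v (f c) (t c) × Emits U′ (p v) v (t c) (f c)
      edges′ c<1+i with m<1+n⇒m<n∨m≡n c<1+i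
      ... | inj₁ c<i  = U⊆ ∘ proj₁ (edges c<i) , U⊆ ∘ proj₂ (edges c<i)
      ... | inj₂ refl = edge , edge′

      scan-skip : ¬ Up d v i → Scanning f t (suc i) last U′
      scan-skip ¬up = record { trees = trees′ ; edges = edges′ ; climb = climb′ climb }
        where
        climb′ : Climbed U ⊎ (∀ {x} → x < i → Up d v x → Up d v last × s x ≡ s last) →
                 Climbed U′ ⊎ (∀ {x} → x < suc i → Up d v x → Up d v last × s x ≡ s last)
        climb′ (inj₁ c)    = inj₁ (climbed-mono U⊆ c)
        climb′ (inj₂ same) = inj₂ same′
          where
          same′ : ∀ {x} → x < suc i → Up d v x → Up d v last × s x ≡ s last
          same′ x<1+i ux with m<1+n⇒m<n∨m≡n x<1+i
          ... | inj₁ x<i  = same x<i ux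
          ... | inj₂ refl = ⊥-elim (¬up ux)

      scan-up : Up d v i → Scanning f t (suc i) i U′
      scan-up ui = record { trees = trees′ ; edges = edges′ ; climb = climb′ climb }
        where
        climb′ : Climbed U ⊎ (∀ {x} → x < i → Up d v x → Up d v last × s x ≡ s last) →
                 Climbed U′ ⊎ (∀ {x} → x < suc i → Up d v x → Up d v i × s x ≡ s i)
        climb′ (inj₁ c) = inj₁ (climbed-mono U⊆ c)
        -- Here `last` may still be the placeholder, hence the test that it is an upper neighbour.
        climb′ (inj₂ same) with up? d v last ×-dec ¬? (s i Bool.≟ s last)
        ... | yes (ul , s≢) = inj₁ (i , last , ui , ul , s≢ , pair , pair′)
        ... | no ¬cross     = inj₂ same′
          where
          same′ : ∀ {x} → x < suc i → Up d v x → Up d v i × s x ≡ s i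
          same′ x<1+i ux with m<1+n⇒m<n∨m≡n x<1+i
          ... | inj₂ refl = ui , refl
          ... | inj₁ x<i with same x<i ux
          ...   | ul , s≡ = ui , trans s≡ (sym (decidable-stable (s i Bool.≟ s last) (λ s≢ → ¬cross (ul , s≢))))

  ScanningAt : (v i : ℕ) → Config n → Set
  ScanningAt v i κ = Scanning (cells κ levels) (cells κ parents) v
    (cells κ mergeFrom) (cells κ mergeTo) i (regs κ 4) (found κ)

  emissions-emit : ∀ κ → EmittedAt (cells κ levels) (cells κ parents) (regs κ 1)
    (cells κ mergeFrom) (cells κ mergeTo) (regs κ 2) (regs κ 4) (found (run G emissions κ))
  emissions-emit κ = record
    { tree  = ++ˡ U₅ E₅ ∘ ++ˡ U₄ E₄ ∘ ++ˡ U₃ E₃ ∘ ++ˡ U₂ E₂ ∘ ∈-++⁺ʳ U₁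
    ; edge  = ++ˡ U₅ E₅ ∘ ++ˡ U₄ E₄ ∘ ++ˡ U₃ E₃ ∘ ∈-++⁺ʳ U₂
    ; edge′ = ++ˡ U₅ E₅ ∘ ++ˡ U₄ E₄ ∘ ∈-++⁺ʳ U₃
    ; pair  = ++ˡ U₅ E₅ ∘ ∈-++⁺ʳ U₄
    ; pair′ = ∈-++⁺ʳ U₅ }
    where
    ++ˡ : ∀ (U V : List (Tuple n)) → U ⊆ U ++ V
    ++ˡ U V = ∈-++⁺ˡ
    v = regs κ 1 ; i = regs κ 2 ; last = regs κ 4
    p = cells κ parents ; f = cells κ mergeFrom ; t = cells κ mergeTo
    E₁ = emitted G (p v) v (p i) i
    E₂ = emitted G (p v) v (f i) (t i)
    E₃ = emitted G (p v) v (t i) (f i)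
    E₄ = emitted G (p i) i last v
    E₅ = emitted G (p last) last i v
    U₁ = found κ
    U₂ = U₁ ++ E₁
    U₃ = U₂ ++ E₂
    U₄ = U₃ ++ E₃
    U₅ = U₄ ++ E₄

  scan-visit : ∀ {v i} κ → regs κ 1 ≡ v → regs κ 2 ≡ i → ScanningAt v i κ → ScanningAt v (suc i) (run G scan κ)
  scan-visit κ refl refl S = when-elim G climbs (set 4 (var 2)) (run G emissions κ) (ScanningAt v (suc i))
    (λ ≡0 → scan-skip _ _ _ U⊆ E S λ ui → climbs≢0 ui ≡0)
    (λ ≢0 → scan-up _ _ _ U⊆ E S (up (adjacency≢0⇒Adj G i v (factorˡ≢0 (adjacency G i v) _ ≢0))
      (trans (+-comm 1 _) (==ᵉ⇒≡ _ _ (factorʳ≢0 (adjacency G i v) _ ≢0)))))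
    where
    v = regs κ 1
    i = regs κ 2
    d = cells κ levels
    E = emissions-emit κ
    U⊆ = found-⊆ G emissions κ
    climbs≢0 : Up d v i → value G κ climbs ≢ 0
    climbs≢0 (up e l) = product≢0 _ _ (Adj⇒≢0 G e)
      (subst (λ k → 1 ∸ ((d i + 1 ∸ k) + (k ∸ (d i + 1))) ≢ 0) (trans (+-comm (d i) 1) l) (≡⇒==ᵉ (d i + 1)))

  ProcessedAt : ℕ → Config n → Set
  ProcessedAt v κ = Processed (cells κ levels) (cells κ parents) v (found κ)

  process-visit : ∀ κ → ProcessedAt (regs κ 1) (run G process κ)
  process-visit κ = processed _ _ _ scanned crossed
    where
    v = regs κ 1
    κ₁ = run G forest κ
    κ₂ = run G (set 4 (var 1)) κ₁
    κ₃ = run G (for 2 scan) κ₂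
    scanned : ScanningAt v n κ₃
    scanned = for-invariant G 2 scan κ₂ (ScanningAt v) refl
      (record { trees = λ () ; edges = λ () ; climb = inj₂ λ () })
      λ κ′ _ r₂ fr S → scan-visit κ′ (trans (Frame.regs-≡ fr 1 refl) (frame-regs G forest 1 κ refl)) r₂ S
    kept : ∀ a → puts forest a ≡ false → cells κ₃ a ≡ cells κ a
    kept a eq = trans (frame-cells G (for 2 scan) a κ₂ refl) (frame-cells G forest a κ eq)
    crossed : ∀ {x y} → Kept G (cells κ₃ parents v) v x y → s x ≢ s y →
      Merging.Crossed n (Kept G (cells κ₃ parents v) v) s (cells κ₃ mergeFrom) (cells κ₃ mergeTo)
    crossed K s≢ = subst₂ (Merging.Crossed n (Kept G (cells κ₃ parents v) v) s)
      (sym (frame-cells G (for 2 scan) mergeFrom κ₂ refl)) (sym (frame-cells G (for 2 scan) mergeTo κ₂ refl))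
      (forest-crossing G s (cells κ₃ parents v) v κ (refl , cong (λ p → p v) (sym (kept parents refl))) K s≢)

  -- Later vertices change neither levels nor parents, and the output only grows.
  all-processed : ∀ κ → ∀ {v} → v < n → ProcessedAt v (run G (for 1 process) κ)
  all-processed κ = for-invariant G 1 process κ (λ i κ′ → ∀ {v} → v < i → ProcessedAt v κ′) refl (λ ())
    λ κ′ _ r₁ _ P → visit κ′ r₁ P
    where
    visit : ∀ κ′ {i} → regs κ′ 1 ≡ i → (∀ {v} → v < i → ProcessedAt v κ′) →
      ∀ {v} → v < suc i → ProcessedAt v (run G process κ′)
    visit κ′ refl P {v} v<1+i with m<1+n⇒m<n∨m≡n v<1+i
    ... | inj₂ refl = process-visit κ′
    ... | inj₁ v<i  = subst₂ (λ d p → Processed d p v (found (run G process κ′)))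
      (sym (frame-cells G process levels κ′ refl)) (sym (frame-cells G process parents κ′ refl))
      (processed-mono _ _ _ (found-⊆ G process κ′) (P v<i))

  bfsTree : Connected G → 0 < n → ∀ κ → cells κ ≡ (λ _ _ → 0) →
    BFSTree G (cells (run G universalSet κ) levels) (cells (run G universalSet κ) parents)
  bfsTree conn 0<n κ κ≡0 = subst₂ (BFSTree G)
    (sym (frame-cells G (for 1 process) levels (run G bfs κ) refl))
    (sym (frame-cells G (for 1 process) parents (run G bfs κ) refl))
    (layered⇒BFSTree G 0<n (bfs-layered G κ κ≡0) conn)

-- Candidates compatible with a 2-join

-- A 2-join with A = A₁ ∪ A₂ and B = B₁ ∪ B₂, where s tells the side of a vertex.
record Split {n : ℕ} (G : Graph n) (s : ℕ → Bool) : Set₁ where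
  field
    A B        : ℕ → Set
    A-complete : ∀ {u v} → A u → A v → s u ≢ s v → Adj G u v
    B-complete : ∀ {u v} → B u → B v → s u ≢ s v → Adj G u v
    AB-disjoint : ∀ {u} → A u → B u → ⊥
    crossing   : ∀ {u v} → Adj G u v → s u ≢ s v → (A u × A v) ⊎ (B u × B v)
    A-nonempty : ∀ σ → ∃[ u ] u < n × A u × s u ≡ σ
    B-nonempty : ∀ σ → ∃[ u ] u < n × B u × s u ≡ σ

swap : ∀ {n} {G : Graph n} {s} → Split G s → Split G s
swap J = record
  { A = B ; B = A ; A-complete = B-complete ; B-complete = A-complete
  ; AB-disjoint = λ b a → AB-disjoint a b
  ; crossing = λ e s≢ → Sum.swap (crossing e s≢)
  ; A-nonempty = B-nonempty ; B-nonempty = A-nonempty }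
  where
  open Split J

same-side : ∀ {a b c : Bool} → a ≢ c → b ≢ c → a ≡ b
same-side a≢c b≢c = trans (Bool.¬-not a≢c) (sym (Bool.¬-not b≢c))

module _ {n : ℕ} (G : Graph n) (s : ℕ → Bool) (d p : ℕ → ℕ) (U : List (Tuple n))
         (0<n : 0 < n) (tree : BFSTree G d p) (done : ∀ {v} → v < n → Processed G s d p v U) where
  open BFSTree tree

  Hit : Set
  Hit = ∃[ a₁ ] ∃[ a₂ ] ∃[ b₁ ] ∃[ b₂ ] Emits G s U a₁ a₂ b₁ b₂ × IsProper G a₁ a₂ b₁ b₂
    × s a₁ ≡ s b₁ × s a₂ ≡ s b₂ × s a₁ ≢ s a₂

  Near : ℕ → Set
  Near x = s x ≡ s 0

  apart : ∀ {x y} → Near x → ¬ Near y → s x ≢ s y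
  apart near-x far-y s≡ = far-y (trans (sym s≡) near-x)

  opposite⇒far : ∀ {x} → s x ≡ not (s 0) → ¬ Near x
  opposite⇒far s≡ near = Bool.not-¬ refl (trans (sym near) s≡)

  module _ (J : Split G s) where
    open Split J

    -- The non-edges of properness hold because an edge from A to B across the sides would be of one
    -- of the two types, which puts one of its ends into both A and B.
    hit : ∀ {a₁ a₂ b₁ b₂} → A a₁ → A a₂ → B b₁ → B b₂ → Near a₁ → ¬ Near a₂ → Near b₁ → ¬ Near b₂ →
          Emits G s U a₁ a₂ b₁ b₂ → Hit
    hit {a₁} {a₂} {b₁} {b₂} Aa₁ Aa₂ Bb₁ Bb₂ na₁ fa₂ nb₁ fb₂ em =
      a₁ , a₂ , b₁ , b₂ , em , record
        { a₁~a₂ = A-complete Aa₁ Aa₂ (apart na₁ fa₂)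
        ; b₁~b₂ = B-complete Bb₁ Bb₂ (apart nb₁ fb₂)
        ; a₁≁b₂ = λ e → AB-≁ Aa₁ Bb₂ (apart na₁ fb₂) e
        ; b₁≁a₂ = λ e → AB-≁ Aa₂ Bb₁ (apart nb₁ fa₂ ∘ sym) (Adj-sym G e)
        ; a₁≢b₂ = λ { refl → AB-disjoint Aa₁ Bb₂ }
        ; b₁≢a₂ = λ { refl → AB-disjoint Aa₂ Bb₁ } }
      , trans na₁ (sym nb₁) , same-side fa₂ fb₂ , apart na₁ fa₂
      where
      AB-≁ : ∀ {a b} → A a → B b → s a ≢ s b → ¬ Adj G a b
      AB-≁ Aa Bb s≢ e with crossing e s≢
      ... | inj₁ (_ , Ab) = AB-disjoint Ab Bb
      ... | inj₂ (Ba , _) = AB-disjoint Aa Ba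

    module _ {x : ℕ} (x<n : x < n) (far : ¬ Near x) (nearer : ∀ {y} → y < n → d y < d x → Near y)
             (Aa : A (p x)) (Ax : A x) where

      far⇒≢0 : ∀ {y} → ¬ Near y → y ≢ 0
      far⇒≢0 fy refl = fy refl

      a = p x

      -- The parent is one level closer to the root than `x`, and `x` has minimal level among the
      -- vertices on the far side.
      near-parent : ∀ {y} → y < n → ¬ Near y → d y ≡ d x → Near (p y)
      near-parent y<n fy dy≡dx = nearer (proj₁ (Adj⇒< G (parent~ y<n (far⇒≢0 fy))))
        (≤-reflexive (trans (sym (level y<n (far⇒≢0 fy))) dy≡dx))

      near-a : Near a
      near-a = near-parent x<n far refl

      far-side : ∀ {y z} → s y ≢ s z → Near y → ¬ Near z
      far-side s≢ ny nz = s≢ (trans ny (sym nz))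

      near-side : ∀ {y z} → s y ≢ s z → ¬ Near y → Near z
      near-side s≢ fy = same-side (s≢ ∘ sym) (fy ∘ sym)

      -- If the edge had its ends in A, then `x` would be adjacent to its near end and `a` to its
      -- far end, and it would have been deleted. For an edge in B, the nearer end selects the
      -- orientation.
      kept-hit : ∀ {y z} → Kept G a x y z → s y ≢ s z →
        Emits G s U a x y z → Emits G s U a x z y → Hit
      kept-hit {y} {z} K s≢ em em′ with crossing (Kept.edge K) s≢ | s y Bool.≟ s 0
      ... | inj₁ (Ay , Az) | yes ny = ⊥-elim (Kept.not-across′ K
              (A-complete Aa Az (apart near-a (far-side s≢ ny)) , A-complete Ax Ay (apart ny far ∘ sym)))
      ... | inj₁ (Ay , Az) | no fy  = ⊥-elim (Kept.not-across K
              (A-complete Aa Ay (apart near-a fy) , A-complete Ax Az (apart (near-side s≢ fy) far ∘ sym)))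
      ... | inj₂ (By , Bz) | yes ny = hit Aa Ax By Bz near-a far ny (far-side s≢ ny) em
      ... | inj₂ (By , Bz) | no fy  = hit Aa Ax Bz By near-a far (near-side s≢ fy) fy em′

      climb-hit : ∀ {b y z} → b < n → B b → ¬ Near b → d b ≡ suc (d x) → Up G s d b y → Up G s d b z →
        ¬ Near y → Near z → Emits G s U (p y) y z b → Hit
      climb-hit {b} {y} {z} b<n Bb fb db≡ uy uz fy nz em
        with crossing (Up.edge uz) (apart nz fb)
      ... | inj₁ (_ , Ab) = ⊥-elim (AB-disjoint Ab Bb)
      ... | inj₂ (Bz , _) = by-type (crossing (parent~ y<n (far⇒≢0 fy)) (apart near fy))
        where
        y<n = proj₁ (Adj⇒< G (Up.edge uy))
        -- As `y` is one level before `b` and `b` one level after `x`, the vertex `y` is on the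
        -- level of `x`.
        near = near-parent y<n fy (suc-injective (trans (Up.level uy) db≡))
        by-type : (A (p y) × A y) ⊎ (B (p y) × B y) → Hit
        by-type (inj₁ (Apy , Ay)) = hit Apy Ay Bz Bb near fy nz fb em
        by-type (inj₂ (Bpy , By)) = hit Aa Ax Bpy By near-a far near fy (Processed.trees (done x<n) y<n)

      square-hit : ∀ {b₁ b₂} → B b₂ → Near b₁ → ¬ Near b₂ → Adj G b₁ b₂ → Adj G a b₁ → Adj G x b₂ → Hit
      square-hit {b₁} {b₂} Bb₂ nb₁ fb₂ b₁~b₂ a~b₁ x~b₂ with d b₂ ≟ d x
      ... | yes db₂≡dx = same-level (crossing (parent~ b₂<n (far⇒≢0 fb₂)) (apart near fb₂))
        where
        b₂<n = proj₂ (Adj⇒< G x~b₂)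
        near = near-parent b₂<n fb₂ db₂≡dx
        same-level : (A (p b₂) × A b₂) ⊎ (B (p b₂) × B b₂) → Hit
        same-level (inj₁ (_ , Ab₂)) = ⊥-elim (AB-disjoint Ab₂ Bb₂)
        same-level (inj₂ (Bq , _))  =
          hit Aa Ax Bq Bb₂ near-a far near fb₂ (Processed.trees (done x<n) b₂<n)
      ... | no db₂≢dx = next-level (Processed.climb (done b₂<n) (up x~b₂ (sym db₂≡))
                          (up b₁~b₂ (trans (cong suc db₁≡) (sym db₂≡))) (apart nb₁ far ∘ sym))
        where
        b₂<n = proj₂ (Adj⇒< G x~b₂)
        dx≤db₂ : d x ≤ d b₂
        dx≤db₂ = ≮⇒≥ (fb₂ ∘ nearer b₂<n)
        db₂≡ : d b₂ ≡ suc (d x)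
        db₂≡ = ≤-antisym (closed x~b₂) (≤∧≢⇒< dx≤db₂ (db₂≢dx ∘ sym))
        -- The neighbours `a` and `b₂` of `b₁` are one level before and one level after `x`.
        db₁≡ : d b₁ ≡ d x
        db₁≡ = ≤-antisym
          (≤-trans (closed a~b₁) (≤-reflexive (sym (level x<n (far⇒≢0 far)))))
          (s≤s⁻¹ (≤-trans (≤-reflexive (sym db₂≡)) (closed b₁~b₂)))
        next-level : Climbed G s d p b₂ U → Hit
        next-level (y , z , uy , uz , s≢ , em , em′) with s y Bool.≟ s 0
        ... | no fy  = climb-hit b₂<n Bb₂ fb₂ db₂≡ uy uz fy (near-side s≢ fy) em
        ... | yes ny = climb-hit b₂<n Bb₂ fb₂ db₂≡ uz uy (far-side s≢ ny) ny em′

      first-edge-hit : Hit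
      first-edge-hit with B-nonempty (s 0) | B-nonempty (not (s 0))
      ... | b₁ , _ , Bb₁ , nb₁ | b₂ , _ , Bb₂ , sb₂≡
        with adjacency G a b₁ ≟ 1 ×-dec adjacency G x b₂ ≟ 1
      ...   | yes (a~b₁ , x~b₂) = square-hit Bb₂ nb₁ fb₂ (B-complete Bb₁ Bb₂ (apart nb₁ fb₂)) a~b₁ x~b₂
        where
        fb₂ = opposite⇒far sb₂≡
      ...   | no ¬square = uncurry-hit (Processed.crosses (done x<n) K (apart nb₁ fb₂))
        where
        fb₂ = opposite⇒far sb₂≡
        a≁b₂ : ¬ Adj G a b₂
        a≁b₂ e with crossing e (apart near-a fb₂)
        ... | inj₁ (_ , Ab₂) = AB-disjoint Ab₂ Bb₂
        ... | inj₂ (Ba , _)  = AB-disjoint Aa Ba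
        K : Kept G a x b₁ b₂
        -- The absence of the square is the first condition for being kept. The second holds because
        -- `a`, in A, and `b₂`, in B, are on different sides.
        K = record { edge = B-complete Bb₁ Bb₂ (apart nb₁ fb₂) ; not-across = ¬square ; not-across′ = a≁b₂ ∘ proj₁ }
        uncurry-hit : ∃[ y ] ∃[ z ] Kept G a x y z × s y ≢ s z × Emits G s U a x y z × Emits G s U a x z y → Hit
        uncurry-hit (_ , _ , K′ , s≢ , em , em′) = kept-hit K′ s≢ em em′

  nearest : ∀ m {x} → d x < m → x < n → ¬ Near x →
    ∃[ y ] y < n × ¬ Near y × (∀ {z} → z < n → d z < d y → Near z)
  nearest (suc m) {x} (s≤s dx≤m) x<n fx with anyUpTo? (λ z → d z <? d x ×-dec ¬? (s z Bool.≟ s 0)) n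
  ... | yes (z , z<n , dz<dx , fz) = nearest m (≤-trans dz<dx dx≤m) z<n fz
  ... | no none = x , x<n , fx , λ {z} z<n dz<dx →
    decidable-stable (s z Bool.≟ s 0) (λ fz → none (z , z<n , dz<dx , fz))

  split-hit : Split G s → Hit
  split-hit J with Split.A-nonempty J (not (s 0))
  ... | x , x<n , _ , sx≡ with nearest (suc (d x)) ≤-refl x<n (opposite⇒far sx≡)
  ...   | y , y<n , fy , nearer with Split.crossing J (parent~ y<n y≢0) parent-apart
    where
    y≢0 : y ≢ 0
    y≢0 refl = fy refl
    parent-apart : s (p y) ≢ s y
    parent-apart s≡ = fy (trans (sym s≡)
      (nearer (proj₁ (Adj⇒< G (parent~ y<n y≢0))) (≤-reflexive (sym (level y<n y≢0)))))
  ...     | inj₁ (Ap , Ay) = first-edge-hit J y<n fy nearer Ap Ay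
  -- Exchanging A and B reduces this to a tree edge of type A.
  ...     | inj₂ (Bp , By) = first-edge-hit (swap J) y<n fy nearer Bp By

-- From 2-joins to splits, and back to compatible tuples

module _ {n : ℕ} (G : Graph n) (X₁ X₂ : Subset n) (J : TwoJoin G X₁ X₂) where
  open TwoJoin J
  open Graph G using (_~_) renaming (sym to ~-sym)

  side : ℕ → Bool
  side v with v <? n
  ... | yes v<n = does (fromℕ< v<n ∈? X₁)
  -- A default for numbers that name no vertex.
  ... | no _    = false

  side-toℕ : ∀ x → side (toℕ x) ≡ does (x ∈? X₁)
  side-toℕ x with toℕ x <? n
  ... | yes x<n = cong (λ y → does (y ∈? X₁)) (fromℕ<-toℕ x x<n)
  ... | no x≮n  = ⊥-elim (x≮n (toℕ<n x))

  X₁⇒side : ∀ {x} → x ∈ˢ X₁ → side (toℕ x) ≡ true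
  X₁⇒side {x} x∈ = trans (side-toℕ x) (dec-true (x ∈? X₁) x∈)

  X₂⇒side : ∀ {x} → x ∈ˢ X₂ → side (toℕ x) ≡ false
  X₂⇒side {x} x∈ = trans (side-toℕ x)
    (dec-false (x ∈? X₁) (λ x∈₁ → disjoint (x , x∈p∩q⁺ (x∈₁ , x∈))))

  side⇒X₁ : ∀ {x} → side (toℕ x) ≡ true → x ∈ˢ X₁
  side⇒X₁ {x} eq with covering x
  ... | inj₁ x∈ = x∈
  ... | inj₂ x∈ with () ← trans (sym eq) (X₂⇒side x∈)

  side⇒X₂ : ∀ {x} → side (toℕ x) ≡ false → x ∈ˢ X₂
  side⇒X₂ {x} eq with covering x
  ... | inj₂ x∈ = x∈
  ... | inj₁ x∈ with () ← trans (sym eq) (X₁⇒side x∈)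

  Union : (Y₁ Y₂ : Subset n) → ℕ → Set
  Union Y₁ Y₂ v = ∃[ x ] toℕ x ≡ v × (x ∈ˢ Y₁ ⊎ x ∈ˢ Y₂)

  union-complete : ∀ {Y₁ Y₂} → Y₁ ⊆ˢ X₁ → Y₂ ⊆ˢ X₂ → (∀ {x y} → x ∈ˢ Y₁ → y ∈ˢ Y₂ → x ~ y) →
    ∀ {u v} → Union Y₁ Y₂ u → Union Y₁ Y₂ v → side u ≢ side v → Adj G u v
  union-complete ⊆₁ ⊆₂ comp (x , refl , inj₁ x∈) (y , refl , inj₁ y∈) s≢ =
    ⊥-elim (s≢ (trans (X₁⇒side (⊆₁ x∈)) (sym (X₁⇒side (⊆₁ y∈)))))
  union-complete ⊆₁ ⊆₂ comp (x , refl , inj₁ x∈) (y , refl , inj₂ y∈) s≢ = ~⇒Adj G (comp x∈ y∈)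
  union-complete ⊆₁ ⊆₂ comp (x , refl , inj₂ x∈) (y , refl , inj₁ y∈) s≢ = ~⇒Adj G (~-sym (comp y∈ x∈))
  union-complete ⊆₁ ⊆₂ comp (x , refl , inj₂ x∈) (y , refl , inj₂ y∈) s≢ =
    ⊥-elim (s≢ (trans (X₂⇒side (⊆₂ x∈)) (sym (X₂⇒side (⊆₂ y∈)))))

  union-nonempty : ∀ {Y₁ Y₂} → Y₁ ⊆ˢ X₁ → Y₂ ⊆ˢ X₂ → Nonempty Y₁ → Nonempty Y₂ →
    ∀ σ → ∃[ u ] u < n × Union Y₁ Y₂ u × side u ≡ σ
  union-nonempty ⊆₁ ⊆₂ (x , x∈) _ true  = toℕ x , toℕ<n x , (x , refl , inj₁ x∈) , X₁⇒side (⊆₁ x∈)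
  union-nonempty ⊆₁ ⊆₂ _ (x , x∈) false = toℕ x , toℕ<n x , (x , refl , inj₂ x∈) , X₂⇒side (⊆₂ x∈)

  split : Split G side
  split = record
    { A = Union A₁ A₂
    ; B = Union B₁ B₂
    ; A-complete = union-complete A₁⊆X₁ A₂⊆X₂ A-complete
    ; B-complete = union-complete B₁⊆X₁ B₂⊆X₂ B-complete
    ; AB-disjoint = AB-disjoint
    ; crossing = crossing
    ; A-nonempty = union-nonempty A₁⊆X₁ A₂⊆X₂ A₁-nonempty A₂-nonempty
    ; B-nonempty = union-nonempty B₁⊆X₁ B₂⊆X₂ B₁-nonempty B₂-nonempty
    }
    where
    AB-disjoint : ∀ {u} → Union A₁ A₂ u → Union B₁ B₂ u → ⊥
    AB-disjoint (x , refl , x∈) (y , y≡x , y∈) with toℕ-injective y≡x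
    AB-disjoint (x , refl , inj₁ x∈) (y , y≡x , inj₁ y∈) | refl = A₁B₁-disjoint (x , x∈p∩q⁺ (x∈ , y∈))
    AB-disjoint (x , refl , inj₁ x∈) (y , y≡x , inj₂ y∈) | refl = disjoint (x , x∈p∩q⁺ (A₁⊆X₁ x∈ , B₂⊆X₂ y∈))
    AB-disjoint (x , refl , inj₂ x∈) (y , y≡x , inj₁ y∈) | refl = disjoint (x , x∈p∩q⁺ (B₁⊆X₁ y∈ , A₂⊆X₂ x∈))
    AB-disjoint (x , refl , inj₂ x∈) (y , y≡x , inj₂ y∈) | refl = A₂B₂-disjoint (x , x∈p∩q⁺ (x∈ , y∈))
    crossing : ∀ {u v} → Adj G u v → side u ≢ side v →
      (Union A₁ A₂ u × Union A₁ A₂ v) ⊎ (Union B₁ B₂ u × Union B₁ B₂ v)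
    crossing u~v s≢ with Adj⇒~ G u~v
    ... | x , y , refl , refl , x~y with covering x | covering y
    ...   | inj₁ x∈ | inj₁ y∈ = ⊥-elim (s≢ (trans (X₁⇒side x∈) (sym (X₁⇒side y∈))))
    ...   | inj₂ x∈ | inj₂ y∈ = ⊥-elim (s≢ (trans (X₂⇒side x∈) (sym (X₂⇒side y∈))))
    ...   | inj₁ x∈ | inj₂ y∈ with no-other x∈ y∈ x~y
    ...     | inj₁ (xA , yA) = inj₁ ((x , refl , inj₁ xA) , (y , refl , inj₂ yA))
    ...     | inj₂ (xB , yB) = inj₂ ((x , refl , inj₁ xB) , (y , refl , inj₂ yB))
    crossing u~v s≢ | x , y , refl , refl , x~y | inj₂ x∈ | inj₁ y∈ with no-other y∈ x∈ (~-sym x~y)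
    ...     | inj₁ (yA , xA) = inj₁ ((x , refl , inj₂ xA) , (y , refl , inj₁ yA))
    ...     | inj₂ (yB , xB) = inj₂ ((x , refl , inj₂ xB) , (y , refl , inj₁ yB))

  -- If `a₁` is in X₁, the first emitted tuple is compatible; otherwise its mirror image, the second
  -- one, is.
  compatible : ∀ {U a₁ a₂ b₁ b₂} → emitted G a₁ a₂ b₁ b₂ ⊆ U → IsProper G a₁ a₂ b₁ b₂ →
    side a₁ ≡ side b₁ → side a₂ ≡ side b₂ → side a₁ ≢ side a₂ → Any (Compatible X₁ X₂) U
  compatible {U} {a₁} {a₂} {b₁} {b₂} em prop s₁ s₂ s≢ with emitted G a₁ a₂ b₁ b₂ | emitView G a₁ a₂ b₁ b₂
  ... | _ | rejected ≡0 = ⊥-elim (IsProper⇒properness≢0 G prop ≡0)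
  ... | _ | accepted _ q (refl , refl , refl , refl) = by-side _ _ refl refl
    where
    by-side : ∀ σ τ → side a₁ ≡ σ → side a₂ ≡ τ → Any (Compatible X₁ X₂) U
    by-side true  true  a₁≡ a₂≡ = ⊥-elim (s≢ (trans a₁≡ (sym a₂≡)))
    by-side false false a₁≡ a₂≡ = ⊥-elim (s≢ (trans a₁≡ (sym a₂≡)))
    by-side true  false a₁≡ a₂≡ = lose (em (here refl))
      (side⇒X₁ a₁≡ , side⇒X₁ (trans (sym s₁) a₁≡) , side⇒X₂ a₂≡ , side⇒X₂ (trans (sym s₂) a₂≡))
    by-side false true  a₁≡ a₂≡ = lose (em (there (here refl)))
      (side⇒X₁ a₂≡ , side⇒X₁ (trans (sym s₂) a₂≡) , side⇒X₂ a₁≡ , side⇒X₂ (trans (sym s₁) a₁≡))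

-- Size, running time and word size of the final program

module _ {n : ℕ} (G : Graph n) (conn : Connected G) where

  start : Config n
  start = config ((λ _ → 0) [ 0 ↦ n ]) (λ _ _ → 0) []

  final : Config n
  final = run G universalSet start

  instance
    n≢0 : NonZero n
    n≢0 = >-nonZero 0<n
      where 0<n = ≤-trans (s≤s z≤n) (toℕ<n (Connected.vertex conn))

  found-universal : UniversalSet G (found final)
  found-universal = record
    { proper    = subst (All (Proper G)) (sym (Extends.U′≡ ext)) (Extends.propers ext)
    ; universal = λ X₁ X₂ J →
        let s = side G X₁ X₂ J
            _ , _ , _ , _ , em , prop , s₁ , s₂ , s≢ =
              split-hit G s (cells final levels) (cells final parents) (found final) (>-nonZero⁻¹ n)
                (bfsTree G s conn (>-nonZero⁻¹ n) start refl)
                (all-processed G s (run G bfs start)) (split G X₁ X₂ J)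
        in compatible G X₁ X₂ J em prop s₁ s₂ s≢
    }
    where ext = run-extends G universalSet start

  length-found : length (found final) ≤ 10 * n ^ 2
  length-found = ≤-trans (≤-reflexive (cong length (Extends.U′≡ ext))) (≤-trans (Extends.length≤ ext)
    (≤-reflexive outputs≡))
    where
    ext = run-extends G universalSet start
    outputs≡ : outputs universalSet n ≡ 10 * n ^ 2
    -- The zeros come from the parts without emissions. In the remaining double loop there are five
    -- emissions of at most two tuples each.
    outputs≡ = solve 1 (λ n →
      n :* (n :* (n :* con 0)) :+ n :* (n :* con 0 :+ n :* (n :* con 0 :+ n :* con 0) :+ n :* con 10)
        := con 10 :* (n :* (n :* con 1))) refl n
      where
      open +-*-Solver

  final-computed : ∀ {W T} → n + factor universalSet * n ^ 3 ≤ W → factor universalSet * n ^ 3 ≤ T →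
    Computes (compile universalSet) W T G (found final)
  final-computed {W} {T} ≤W ≤T =
    -- Well-formedness of the closed program is inferred; the two `refl` say that register 0 is
    -- never set and initially holds n.
    let t , ex , t≤ , _ = exec G universalSet start _ refl refl bounded
                            (≤-trans (+-monoʳ-≤ n (time≤ universalSet n)) ≤W)
    in toState final , t , ex , refl , ≤-trans t≤ (≤-trans (time≤ universalSet n) ≤T)
    where
    bounded : Bounded G n start
    bounded = upd≤ G 0 (λ _ → z≤n) ≤-refl , λ _ _ → z≤n

  -- The word bound uses a single number as both coefficient and exponent, which therefore has to
  -- exceed `F` and be at least 3.
  word-size : ∀ F → n + F * n ^ 3 ≤ (F + 3) * n ^ (F + 3)
  word-size F = begin
    n + F * n ^ 3            ≤⟨ +-monoˡ-≤ (F * n ^ 3) (m≤m*n n (n ^ 2) {{m^n≢0 n 2}}) ⟩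
    suc F * n ^ 3            ≤⟨ *-mono-≤ (≤-trans (≤-reflexive (+-comm 1 F)) (+-monoʳ-≤ F (s≤s z≤n)))
                                          (^-monoʳ-≤ n (m≤n+m 3 F)) ⟩
    (F + 3) * n ^ (F + 3)    ∎
    where open ≤-Reasoning

lemma3p1 : (∃[ C ] ∀ n (G : Graph n) → Connected G →
    ∃[ U ] UniversalSet G U × length U ≤ C * n ^ 2)
    ×
    (∃[ P ] ∃[ k ] ∃[ C ] ∀ n (G : Graph n) → Connected G →
    ∃[ U ] UniversalSet G U × length U ≤ C * n ^ 2
    × Computes P (k * n ^ k) (C * n ^ 3) G U)
lemma3p1 =
    (C , λ n G conn → found (final G conn) , found-universal G conn , size G conn)
  , (compile universalSet , F + 3 , C , λ n G conn → found (final G conn) , found-universal G conn , size G conn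
    , final-computed G conn (word-size G conn F) (*-monoˡ-≤ (n ^ 3) (m≤m+n F 10)))
  where
  F = factor universalSet
  -- One constant for both bounds: `F` for the time and 10 for the size.
  C = F + 10
  size : ∀ {n} (G : Graph n) (conn : Connected G) → length (found (final G conn)) ≤ C * n ^ 2
  size {n} G conn = ≤-trans (length-found G conn) (*-monoˡ-≤ (n ^ 2) (m≤n+m 10 F))
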